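{- Let $q$ be a prime power with $q\equiv1\pmod4$. The Paley sum graph $X_\Sigma(q)$ is a Ramanujan graph. Moreover, if $q=p^{2k}$ with $p$ prime and $\sigma:\mathbb F_q\to\mathbb F_q$ is the automorphism $x\mapsto x^{p^k}$, then the twisted Paley graph $X(q)^\sigma$ and the twisted Paley sum graph $X_\Sigma(q)^\sigma$ are Ramanujan graphs.
   Context: Let $Q=\{x^2:x\in\mathbb F_q^*\}$ be the set of nonzero squares in $\mathbb F_q$. All graphs have vertex set $\mathbb F_q$ and, for each $s\in Q$: the Paley sum graph $X_\Sigma(q)$ has an edge from $x$ to $-x+s$; the twisted Paley graph $X(q)^\sigma$ has an edge from $x$ to $\sigma(x+s)$; the twisted Paley sum graph $X_\Sigma(q)^\sigma$ has an edge from $x$ to $\sigma(-x+s)$. A $k$-regular undirected graph is Ramanujan if every eigenvalue $\lambda$ of its adjacency matrix with $|\lambda|\ne k$ satisfies $|\lambda|\le2\sqrt{k-1}$. -}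

module Defs where

open import Algebra.Apartness.Bundles using (HeytingCommutativeRing; HeytingField)
open import Algebra.Bundles using (CommutativeMonoid; CommutativeRing)
open import Algebra.Bundles.Raw using (RawMonoid)
import Algebra.Definitions.RawMonoid as RawMonoidDefs
import Algebra.Properties.CommutativeSemigroup as CommutativeSemigroupProperties
import Algebra.Properties.Semiring.Exp as SemiringExp
open import Data.Fin.Base using (Fin)
import Data.Fin.Properties as Fin
import Data.Integer.Base as ℤ
import Data.Integer.Properties as ℤ
open import Data.Nat.Base as ℕ using (ℕ; zero; suc; z≤n; s≤s)
open import Data.Nat.Primality using (Prime)
import Data.Nat.Properties as ℕ
import Data.Nat.Tactic.RingSolver as ℕ-Ring
open import Data.Product.Base using (∃; Σ-syntax; _×_; _,_; proj₁; proj₂)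
open import Data.Rational.Base as ℚ using (ℚ; 0ℚ; 1ℚ; mkℚ)
import Data.Rational.Properties as ℚ
import Data.Rational.Solver as ℚ-Solver
import Data.Rational.Unnormalised.Base as ℚᵘ
import Data.Rational.Unnormalised.Properties as ℚᵘ
open import Data.Sum.Base using (inj₁; inj₂)
open import Data.Vec.Base using (count; allFin)
open import Data.Vec.Functional using (Vector)
open import Function.Bundles using (Inverse)
open import Level using (Level; 0ℓ; _⊔_)
  renaming (suc to lsuc)
open import Relation.Binary.PropositionalEquality as ≡ using (_≡_; refl)
open import Relation.Nullary using (¬_; Dec; yes; no)
open import Relation.Nullary.Decidable using (_×-dec_; ¬?; map′)

------------------------------------------------------------------------
-- Real numbers: Cauchy sequences of rationals, identified by _≈ℝ_

Eventually : (ℕ → Set) → Set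
Eventually P = Σ[ N ∈ ℕ ] (∀ n → N ℕ.≤ n → P n)

Cauchy : (ℕ → ℚ) → Set
Cauchy x = ∀ ε → 0ℚ ℚ.< ε →
  Σ[ N ∈ ℕ ] (∀ m n → N ℕ.≤ m → N ℕ.≤ n → ℚ.∣ x m ℚ.- x n ∣ ℚ.< ε)

record ℝ : Set where
  constructor mkℝ
  field
    seq    : ℕ → ℚ
    cauchy : Cauchy seq

open ℝ public

infix 4 _≈ℝ_ _≤ℝ_

_≈ℝ_ : ℝ → ℝ → Set
x ≈ℝ y = ∀ ε → 0ℚ ℚ.< ε → Eventually λ n → ℚ.∣ seq x n ℚ.- seq y n ∣ ℚ.< ε

_≤ℝ_ : ℝ → ℝ → Set
x ≤ℝ y = ∀ ε → 0ℚ ℚ.< ε → Eventually λ n → seq x n ℚ.< seq y n ℚ.+ ε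

module CauchyProperties where
  open ℚ-Solver.+-*-Solver using (solve; _:=_; _:+_; _:-_; :-_)
  open CommutativeSemigroupProperties
    (CommutativeMonoid.commutativeSemigroup ℚ.+-0-commutativeMonoid) using (interchange)

  sub-+ : ∀ a b c d → (a ℚ.+ b) ℚ.- (c ℚ.+ d) ≡ (a ℚ.- c) ℚ.+ (b ℚ.- d)
  sub-+ a b c d = ≡.trans (≡.cong ((a ℚ.+ b) ℚ.+_) (ℚ.neg-distrib-+ c d))
    (interchange a b (ℚ.- c) (ℚ.- d))

  *-distribˡ-sub : ∀ a b d → a ℚ.* (b ℚ.- d) ≡ a ℚ.* b ℚ.- a ℚ.* d
  *-distribˡ-sub a b d = ≡.trans (ℚ.*-distribˡ-+ a b (ℚ.- d))
    (≡.cong (a ℚ.* b ℚ.+_) (≡.sym (ℚ.neg-distribʳ-* a d)))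

  telescope : ∀ u w z → u ℚ.- z ≡ (u ℚ.- w) ℚ.+ (w ℚ.- z)
  telescope = solve 3 (λ u w z → u :- z := (u :- w) :+ (w :- z)) refl

  sub-* : ∀ a b c d → a ℚ.* b ℚ.- c ℚ.* d ≡ a ℚ.* (b ℚ.- d) ℚ.+ d ℚ.* (a ℚ.- c)
  sub-* a b c d = begin
    a ℚ.* b ℚ.- c ℚ.* d
      ≡⟨ telescope (a ℚ.* b) (a ℚ.* d) (c ℚ.* d) ⟩
    (a ℚ.* b ℚ.- a ℚ.* d) ℚ.+ (a ℚ.* d ℚ.- c ℚ.* d)
      ≡⟨ ≡.cong₂ (λ s t → (a ℚ.* b ℚ.- a ℚ.* d) ℚ.+ (s ℚ.- t)) (ℚ.*-comm a d) (ℚ.*-comm c d) ⟩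
    (a ℚ.* b ℚ.- a ℚ.* d) ℚ.+ (d ℚ.* a ℚ.- d ℚ.* c)
      ≡⟨ ≡.sym (≡.cong₂ ℚ._+_ (*-distribˡ-sub a b d) (*-distribˡ-sub d a c)) ⟩
    a ℚ.* (b ℚ.- d) ℚ.+ d ℚ.* (a ℚ.- c) ∎
    where open ≡.≡-Reasoning

  factor : ∀ b c e r → b ℚ.* (e ℚ.* r) ℚ.+ c ℚ.* (e ℚ.* r) ≡ e ℚ.* ((b ℚ.+ c) ℚ.* r)
  factor b c e r = begin
    b ℚ.* (e ℚ.* r) ℚ.+ c ℚ.* (e ℚ.* r) ≡⟨ ≡.sym (ℚ.*-distribʳ-+ (e ℚ.* r) b c) ⟩
    (b ℚ.+ c) ℚ.* (e ℚ.* r)             ≡⟨ ≡.sym (ℚ.*-assoc (b ℚ.+ c) e r) ⟩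
    (b ℚ.+ c) ℚ.* e ℚ.* r               ≡⟨ ≡.cong (ℚ._* r) (ℚ.*-comm (b ℚ.+ c) e) ⟩
    e ℚ.* (b ℚ.+ c) ℚ.* r               ≡⟨ ℚ.*-assoc e (b ℚ.+ c) r ⟩
    e ℚ.* ((b ℚ.+ c) ℚ.* r)             ∎
    where open ≡.≡-Reasoning

  half-pos : ∀ {ε} → 0ℚ ℚ.< ε → 0ℚ ℚ.< ε ℚ.* ℚ.½
  half-pos {ε} ε>0 = ℚ.*-monoˡ-<-pos ℚ.½ ε>0

  half+half : ∀ ε → ε ℚ.* ℚ.½ ℚ.+ ε ℚ.* ℚ.½ ≡ ε
  half+half ε = ≡.trans (≡.sym (ℚ.*-distribˡ-+ ε ℚ.½ ℚ.½)) (ℚ.*-identityʳ ε)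

  m⊔n≤o⇒m≤o,n≤o : ∀ m n {o} → m ℕ.⊔ n ℕ.≤ o → m ℕ.≤ o × n ℕ.≤ o
  m⊔n≤o⇒m≤o,n≤o m n le = ℕ.m⊔n≤o⇒m≤o m n le , ℕ.m⊔n≤o⇒n≤o m n le

  ∣p-q∣<ε : ∀ {p q ε} → p ℚ.- q ℚ.< ε → q ℚ.- p ℚ.< ε → ℚ.∣ p ℚ.- q ∣ ℚ.< ε
  ∣p-q∣<ε {p} {q} {ε} h₁ h₂ with ℚ.∣p∣≡p∨∣p∣≡-p (p ℚ.- q)
  ... | inj₁ eq = ≡.subst (ℚ._< ε) (≡.sym eq) h₁
  ... | inj₂ eq = ≡.subst (ℚ._< ε)
    (≡.sym (≡.trans eq (solve 2 (λ a b → :- (a :- b) := b :- a) refl p q))) h₂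

  ∣p∣-∣q∣≤∣p-q∣ : ∀ p q → ℚ.∣ p ∣ ℚ.- ℚ.∣ q ∣ ℚ.≤ ℚ.∣ p ℚ.- q ∣
  ∣p∣-∣q∣≤∣p-q∣ p q = begin
    ℚ.∣ p ∣ ℚ.- ℚ.∣ q ∣
      ≡⟨ ≡.cong (λ t → ℚ.∣ t ∣ ℚ.- ℚ.∣ q ∣) (solve 2 (λ a b → a := (a :- b) :+ b) refl p q) ⟩
    ℚ.∣ (p ℚ.- q) ℚ.+ q ∣ ℚ.- ℚ.∣ q ∣
      ≤⟨ ℚ.+-monoˡ-≤ (ℚ.- ℚ.∣ q ∣) (ℚ.∣p+q∣≤∣p∣+∣q∣ (p ℚ.- q) q) ⟩
    (ℚ.∣ p ℚ.- q ∣ ℚ.+ ℚ.∣ q ∣) ℚ.- ℚ.∣ q ∣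
      ≡⟨ solve 2 (λ a b → (a :+ b) :- b := a) refl ℚ.∣ p ℚ.- q ∣ ℚ.∣ q ∣ ⟩
    ℚ.∣ p ℚ.- q ∣ ∎
    where open ℚ.≤-Reasoning

  const-cauchy : ∀ p → Cauchy (λ _ → p)
  const-cauchy p ε ε>0 = 0 , λ _ _ _ _ →
    ≡.subst (ℚ._< ε) (≡.sym (≡.cong ℚ.∣_∣ (ℚ.+-inverseʳ p))) ε>0

  +-cauchy : ∀ {x y} → Cauchy x → Cauchy y → Cauchy (λ n → x n ℚ.+ y n)
  +-cauchy {x} {y} cx cy ε ε>0 with cx _ (half-pos ε>0) | cy _ (half-pos ε>0)
  ... | M , hx | N , hy = M ℕ.⊔ N , λ m n M⊔N≤m M⊔N≤n →
    let M≤m , N≤m = m⊔n≤o⇒m≤o,n≤o M N M⊔N≤m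
        M≤n , N≤n = m⊔n≤o⇒m≤o,n≤o M N M⊔N≤n
        open ℚ.≤-Reasoning
    in begin-strict
      ℚ.∣ (x m ℚ.+ y m) ℚ.- (x n ℚ.+ y n) ∣
        ≡⟨ ≡.cong ℚ.∣_∣ (sub-+ (x m) (y m) (x n) (y n)) ⟩
      ℚ.∣ (x m ℚ.- x n) ℚ.+ (y m ℚ.- y n) ∣
        ≤⟨ ℚ.∣p+q∣≤∣p∣+∣q∣ (x m ℚ.- x n) (y m ℚ.- y n) ⟩
      ℚ.∣ x m ℚ.- x n ∣ ℚ.+ ℚ.∣ y m ℚ.- y n ∣
        <⟨ ℚ.+-mono-< (hx m n M≤m M≤n) (hy m n N≤m N≤n) ⟩
      ε ℚ.* ℚ.½ ℚ.+ ε ℚ.* ℚ.½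
        ≡⟨ half+half ε ⟩
      ε ∎

  bounded : ∀ {x} → Cauchy x →
    Σ[ B ∈ ℚ ] (0ℚ ℚ.< B × Eventually λ n → ℚ.∣ x n ∣ ℚ.< B)
  bounded {x} cx with cx 1ℚ (ℚ.positive⁻¹ 1ℚ)
  ... | N , h = ℚ.∣ x N ∣ ℚ.+ 1ℚ
    , ℚ.+-mono-≤-< (ℚ.0≤∣p∣ (x N)) (ℚ.positive⁻¹ 1ℚ)
    , N , λ n N≤n → begin-strict
      ℚ.∣ x n ∣
        ≡⟨ solve 2 (λ a b → a := b :+ (a :- b)) refl ℚ.∣ x n ∣ ℚ.∣ x N ∣ ⟩
      ℚ.∣ x N ∣ ℚ.+ (ℚ.∣ x n ∣ ℚ.- ℚ.∣ x N ∣)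
        ≤⟨ ℚ.+-monoʳ-≤ ℚ.∣ x N ∣ (∣p∣-∣q∣≤∣p-q∣ (x n) (x N)) ⟩
      ℚ.∣ x N ∣ ℚ.+ ℚ.∣ x n ℚ.- x N ∣
        <⟨ ℚ.+-monoʳ-< ℚ.∣ x N ∣ (h n N N≤n ℕ.≤-refl) ⟩
      ℚ.∣ x N ∣ ℚ.+ 1ℚ ∎
    where open ℚ.≤-Reasoning

  split : ∀ B C ε → 0ℚ ℚ.< B → 0ℚ ℚ.< C → 0ℚ ℚ.< ε →
    Σ[ δ ∈ ℚ ] (0ℚ ℚ.< δ × B ℚ.* δ ℚ.+ C ℚ.* δ ≡ ε)
  split B C ε B>0 C>0 ε>0 = ε ℚ.* r , ℚ.positive⁻¹ (ε ℚ.* r) {{εr-pos}} ,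
    ≡.trans (factor B C ε r)
      (≡.trans (≡.cong (ε ℚ.*_) (ℚ.*-inverseʳ (B ℚ.+ C) {{nz}})) (ℚ.*-identityʳ ε))
    where
    pos : ℚ.Positive (B ℚ.+ C)
    pos = ℚ.positive (ℚ.+-mono-< B>0 C>0)
    nz : ℚ.NonZero (B ℚ.+ C)
    nz = ℚ.pos⇒nonZero (B ℚ.+ C) {{pos}}
    r : ℚ
    r = (ℚ.1/ (B ℚ.+ C)) {{nz}}
    εr-pos : ℚ.Positive (ε ℚ.* r)
    εr-pos = ℚ.pos*pos⇒pos ε {{ℚ.positive ε>0}} r {{ℚ.1/pos⇒pos (B ℚ.+ C) {{pos}}}}

  *-close : ∀ a b c d {B C δ ε} → B ℚ.* δ ℚ.+ C ℚ.* δ ≡ ε → 0ℚ ℚ.< B → 0ℚ ℚ.< C →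
    ℚ.∣ a ∣ ℚ.< B → ℚ.∣ d ∣ ℚ.< C → ℚ.∣ b ℚ.- d ∣ ℚ.< δ → ℚ.∣ a ℚ.- c ∣ ℚ.< δ →
    ℚ.∣ a ℚ.* b ℚ.- c ℚ.* d ∣ ℚ.< ε
  *-close a b c d {B} {C} {δ} {ε} eq B>0 C>0 a<B d<C b~d a~c = begin-strict
    ℚ.∣ a ℚ.* b ℚ.- c ℚ.* d ∣
      ≡⟨ ≡.cong ℚ.∣_∣ (sub-* a b c d) ⟩
    ℚ.∣ a ℚ.* (b ℚ.- d) ℚ.+ d ℚ.* (a ℚ.- c) ∣
      ≤⟨ ℚ.∣p+q∣≤∣p∣+∣q∣ (a ℚ.* (b ℚ.- d)) (d ℚ.* (a ℚ.- c)) ⟩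
    ℚ.∣ a ℚ.* (b ℚ.- d) ∣ ℚ.+ ℚ.∣ d ℚ.* (a ℚ.- c) ∣
      ≡⟨ ≡.cong₂ ℚ._+_ (ℚ.∣p*q∣≡∣p∣*∣q∣ a (b ℚ.- d)) (ℚ.∣p*q∣≡∣p∣*∣q∣ d (a ℚ.- c)) ⟩
    ℚ.∣ a ∣ ℚ.* ℚ.∣ b ℚ.- d ∣ ℚ.+ ℚ.∣ d ∣ ℚ.* ℚ.∣ a ℚ.- c ∣
      ≤⟨ ℚ.+-mono-≤
           (ℚ.*-monoʳ-≤-nonNeg ℚ.∣ b ℚ.- d ∣ {{ℚ.∣-∣-nonNeg (b ℚ.- d)}} (ℚ.<⇒≤ a<B))
           (ℚ.*-monoʳ-≤-nonNeg ℚ.∣ a ℚ.- c ∣ {{ℚ.∣-∣-nonNeg (a ℚ.- c)}} (ℚ.<⇒≤ d<C)) ⟩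
    B ℚ.* ℚ.∣ b ℚ.- d ∣ ℚ.+ C ℚ.* ℚ.∣ a ℚ.- c ∣
      <⟨ ℚ.+-mono-<
           (ℚ.*-monoʳ-<-pos B {{ℚ.positive B>0}} b~d)
           (ℚ.*-monoʳ-<-pos C {{ℚ.positive C>0}} a~c) ⟩
    B ℚ.* δ ℚ.+ C ℚ.* δ
      ≡⟨ eq ⟩
    ε ∎
    where open ℚ.≤-Reasoning

  *-cauchy : ∀ {x y} → Cauchy x → Cauchy y → Cauchy (λ n → x n ℚ.* y n)
  *-cauchy {x} {y} cx cy ε ε>0 = step (bounded {x} cx) (bounded {y} cy)
    where
    Bounded : (ℕ → ℚ) → Set
    Bounded z = Σ[ B ∈ ℚ ] (0ℚ ℚ.< B × Eventually λ n → ℚ.∣ z n ∣ ℚ.< B)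
    Near : (ℕ → ℚ) → ℚ → Set
    Near z δ = Σ[ N ∈ ℕ ] (∀ m n → N ℕ.≤ m → N ℕ.≤ n → ℚ.∣ z m ℚ.- z n ∣ ℚ.< δ)

    combine : ∀ {B C δ} → 0ℚ ℚ.< B → 0ℚ ℚ.< C → B ℚ.* δ ℚ.+ C ℚ.* δ ≡ ε →
      Eventually (λ n → ℚ.∣ x n ∣ ℚ.< B) → Eventually (λ n → ℚ.∣ y n ∣ ℚ.< C) →
      Near x δ → Near y δ → Near (λ n → x n ℚ.* y n) ε
    combine {B} {C} {δ} B>0 C>0 eq (L₁ , hB) (L₂ , hC) (M , hx) (N , hy) =
      (L₁ ℕ.⊔ L₂) ℕ.⊔ (M ℕ.⊔ N) , λ m n le-m le-n →
      let L≤m , MN≤m = m⊔n≤o⇒m≤o,n≤o (L₁ ℕ.⊔ L₂) (M ℕ.⊔ N) le-m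
          L≤n , MN≤n = m⊔n≤o⇒m≤o,n≤o (L₁ ℕ.⊔ L₂) (M ℕ.⊔ N) le-n
          L₁≤m , _    = m⊔n≤o⇒m≤o,n≤o L₁ L₂ L≤m
          _    , L₂≤n = m⊔n≤o⇒m≤o,n≤o L₁ L₂ L≤n
          M≤m , N≤m = m⊔n≤o⇒m≤o,n≤o M N MN≤m
          M≤n , N≤n = m⊔n≤o⇒m≤o,n≤o M N MN≤n
      in *-close (x m) (y m) (x n) (y n) {B} {C} {δ} {ε} eq B>0 C>0
           (hB m L₁≤m) (hC n L₂≤n) (hy m n N≤m N≤n) (hx m n M≤m M≤n)

    step : Bounded x → Bounded y → Near (λ n → x n ℚ.* y n) ε
    step (B , B>0 , hB) (C , C>0 , hC) =
      let δ , δ>0 , eq = split B C ε B>0 C>0 ε>0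
      in combine {B} {C} {δ} B>0 C>0 eq hB hC (cx δ δ>0) (cy δ δ>0)

  ∣∣-cauchy : ∀ {x} → Cauchy x → Cauchy (λ n → ℚ.∣ x n ∣)
  ∣∣-cauchy {x} cx ε ε>0 with cx ε ε>0
  ... | N , h = N , λ m n N≤m N≤n → ∣p-q∣<ε {ℚ.∣ x m ∣} {ℚ.∣ x n ∣}
    (ℚ.≤-<-trans (∣p∣-∣q∣≤∣p-q∣ (x m) (x n)) (h m n N≤m N≤n))
    (ℚ.≤-<-trans (∣p∣-∣q∣≤∣p-q∣ (x n) (x m)) (h n m N≤n N≤m))

open CauchyProperties

infixl 6 _+ℝ_
infixl 7 _*ℝ_

fromℕ : ℕ → ℝ
fromℕ a = mkℝ (λ _ → ℤ.+ a ℚ./ 1) (const-cauchy (ℤ.+ a ℚ./ 1))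

_+ℝ_ : ℝ → ℝ → ℝ
x +ℝ y = mkℝ (λ n → seq x n ℚ.+ seq y n) (+-cauchy {seq x} {seq y} (cauchy x) (cauchy y))

_*ℝ_ : ℝ → ℝ → ℝ
x *ℝ y = mkℝ (λ n → seq x n ℚ.* seq y n) (*-cauchy {seq x} {seq y} (cauchy x) (cauchy y))

∣_∣ℝ : ℝ → ℝ
∣ x ∣ℝ = mkℝ (λ n → ℚ.∣ seq x n ∣) (∣∣-cauchy {seq x} (cauchy x))

isqrt : ℕ → ℕ
isqrt zero = 0
isqrt (suc n) with suc (isqrt n) ℕ.* suc (isqrt n) ℕ.≤? suc n
... | yes _ = suc (isqrt n)
... | no  _ = isqrt n

isqrt-lower : ∀ n → isqrt n ℕ.* isqrt n ℕ.≤ n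
isqrt-lower zero = z≤n
isqrt-lower (suc n) with suc (isqrt n) ℕ.* suc (isqrt n) ℕ.≤? suc n
... | yes le = le
... | no  _  = ℕ.m≤n⇒m≤1+n (isqrt-lower n)

isqrt-upper : ∀ n → n ℕ.< suc (isqrt n) ℕ.* suc (isqrt n)
isqrt-upper zero = s≤s z≤n
isqrt-upper (suc n) with suc (isqrt n) ℕ.* suc (isqrt n) ℕ.≤? suc n
... | yes _  = ℕ.≤-<-trans (isqrt-upper n)
                 (ℕ.*-mono-< (ℕ.n<1+n (suc (isqrt n))) (ℕ.n<1+n (suc (isqrt n))))
... | no  gt = ℕ.≰⇒> gt

-- Square roots of natural numbers: the n-th approximation to √a is
-- ⌊ N √a ⌋ / N with N = suc n, where isqrt m = ⌊ √m ⌋.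
√-seq : ℕ → ℕ → ℚ
√-seq a n = ℤ.+ isqrt (a ℕ.* (suc n ℕ.* suc n)) ℚ./ suc n

module √Properties where
  open ℚ-Solver.+-*-Solver using (solve; _:=_; _:+_; _:-_)

  frac-< : ∀ a b c d → a ℕ.* suc d ℕ.< b ℕ.* suc c →
           ℤ.+ a ℚ./ suc c ℚ.< ℤ.+ b ℚ./ suc d
  frac-< a b c d lt = ℚ.toℚᵘ-cancel-<
    (ℚᵘ.<-respˡ-≃ (ℚᵘ.≃-sym (ℚ.toℚᵘ-fromℚᵘ (ℚᵘ.mkℚᵘ (ℤ.+ a) c)))
    (ℚᵘ.<-respʳ-≃ (ℚᵘ.≃-sym (ℚ.toℚᵘ-fromℚᵘ (ℚᵘ.mkℚᵘ (ℤ.+ b) d)))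
    (ℚᵘ.*<* (≡.subst₂ ℤ._<_ (ℤ.pos-* a (suc d)) (ℤ.pos-* b (suc c)) (ℤ.+<+ lt)))))

  frac-+ : ∀ a b c → ℤ.+ (a ℕ.+ b) ℚ./ suc c ≡ (ℤ.+ a ℚ./ suc c) ℚ.+ (ℤ.+ b ℚ./ suc c)
  frac-+ a b c = ℚ.toℚᵘ-injective (begin
    ℚ.toℚᵘ (ℤ.+ (a ℕ.+ b) ℚ./ suc c)
      ≈⟨ ℚ.toℚᵘ-fromℚᵘ (ℚᵘ.mkℚᵘ (ℤ.+ (a ℕ.+ b)) c) ⟩
    ℚᵘ.mkℚᵘ (ℤ.+ (a ℕ.+ b)) c
      ≈⟨ ℚᵘ.*≡* (≡.trans (≡.sym (ℤ.pos-* (a ℕ.+ b) (suc c ℕ.* suc c))) (≡.trans (≡.cong ℤ.+_ (lem a b (suc c)))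
           (≡.trans (ℤ.pos-* (a ℕ.* suc c ℕ.+ b ℕ.* suc c) (suc c)) (≡.cong (ℤ._* ℤ.+ suc c)
           (≡.cong₂ ℤ._+_ (ℤ.pos-* a (suc c)) (ℤ.pos-* b (suc c))))))) ⟩
    ℚᵘ.mkℚᵘ (ℤ.+ a) c ℚᵘ.+ ℚᵘ.mkℚᵘ (ℤ.+ b) c
      ≈⟨ ℚᵘ.+-cong (ℚᵘ.≃-sym (ℚ.toℚᵘ-fromℚᵘ (ℚᵘ.mkℚᵘ (ℤ.+ a) c)))
                   (ℚᵘ.≃-sym (ℚ.toℚᵘ-fromℚᵘ (ℚᵘ.mkℚᵘ (ℤ.+ b) c))) ⟩
    ℚ.toℚᵘ (ℤ.+ a ℚ./ suc c) ℚᵘ.+ ℚ.toℚᵘ (ℤ.+ b ℚ./ suc c)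
      ≈⟨ ℚᵘ.≃-sym (ℚ.toℚᵘ-homo-+ (ℤ.+ a ℚ./ suc c) (ℤ.+ b ℚ./ suc c)) ⟩
    ℚ.toℚᵘ ((ℤ.+ a ℚ./ suc c) ℚ.+ (ℤ.+ b ℚ./ suc c)) ∎)
    where
    open ℚᵘ.≃-Reasoning
    lem : ∀ a b c → (a ℕ.+ b) ℕ.* (c ℕ.* c) ≡ (a ℕ.* c ℕ.+ b ℕ.* c) ℕ.* c
    lem = ℕ-Ring.solve-∀

  square-cancel-< : ∀ {m n} → m ℕ.* m ℕ.< n ℕ.* n → m ℕ.< n
  square-cancel-< {m} {n} lt with m ℕ.<? n
  ... | yes m<n = m<n
  ... | no  m≮n with ℕ.<⇒≱ lt (ℕ.*-mono-≤ (ℕ.≮⇒≥ m≮n) (ℕ.≮⇒≥ m≮n))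
  ...   | ()

  √-step : ∀ a m n → √-seq a m ℚ.< √-seq a n ℚ.+ (ℤ.+ 1 ℚ./ suc n)
  √-step a m n = ≡.subst (√-seq a m ℚ.<_)
    (≡.trans (≡.cong (λ k → ℤ.+ k ℚ./ suc n) (ℕ.+-comm 1 t)) (frac-+ t 1 n))
    (frac-< s (suc t) m n (square-cancel-< (begin-strict
      (s ℕ.* N) ℕ.* (s ℕ.* N)                    ≡⟨ swap s N ⟩
      (s ℕ.* s) ℕ.* (N ℕ.* N)                    ≤⟨ ℕ.*-monoˡ-≤ (N ℕ.* N) (isqrt-lower (a ℕ.* (M ℕ.* M))) ⟩
      (a ℕ.* (M ℕ.* M)) ℕ.* (N ℕ.* N)            ≡⟨ swap₂ a (M ℕ.* M) (N ℕ.* N) ⟩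
      (a ℕ.* (N ℕ.* N)) ℕ.* (M ℕ.* M)            <⟨ ℕ.*-monoˡ-< (M ℕ.* M) (isqrt-upper (a ℕ.* (N ℕ.* N))) ⟩
      (suc t ℕ.* suc t) ℕ.* (M ℕ.* M)            ≡⟨ ≡.sym (swap (suc t) M) ⟩
      (suc t ℕ.* M) ℕ.* (suc t ℕ.* M)            ∎)))
    where
    open ℕ.≤-Reasoning
    M = suc m
    N = suc n
    s = isqrt (a ℕ.* (M ℕ.* M))
    t = isqrt (a ℕ.* (N ℕ.* N))
    swap : ∀ x y → (x ℕ.* y) ℕ.* (x ℕ.* y) ≡ (x ℕ.* x) ℕ.* (y ℕ.* y)
    swap = ℕ-Ring.solve-∀
    swap₂ : ∀ x y z → (x ℕ.* y) ℕ.* z ≡ (x ℕ.* z) ℕ.* y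
    swap₂ = ℕ-Ring.solve-∀

  1/suc<ε : ∀ ε → 0ℚ ℚ.< ε → Eventually λ n → ℤ.+ 1 ℚ./ suc n ℚ.< ε
  1/suc<ε ε@(mkℚ (ℤ.+ zero)     d _) ε>0 with ℚ.drop-*<* ε>0
  ... | ℤ.+<+ ()
  1/suc<ε ε@(mkℚ (ℤ.+ (suc e)) d c) _ = suc d , λ n d<n →
    ≡.subst (ℤ.+ 1 ℚ./ suc n ℚ.<_) (ℚ.fromℚᵘ-toℚᵘ ε)
      (frac-< 1 (suc e) n d (ℕ.<-≤-trans
        (≡.subst (ℕ._< suc n) (≡.sym (ℕ.*-identityˡ (suc d))) (s≤s d<n))
        (ℕ.m≤m+n (suc n) (e ℕ.* suc n))))
  1/suc<ε (mkℚ ℤ.-[1+ e ] d _) ε>0 with ℚ.drop-*<* ε>0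
  ... | ()

  √-cauchy : ∀ a → Cauchy (√-seq a)
  √-cauchy a ε ε>0 with 1/suc<ε ε ε>0
  ... | N , h = N , λ m n N≤m N≤n →
    ∣p-q∣<ε {√-seq a m} {√-seq a n} (close m n (h n N≤n)) (close n m (h m N≤m))
    where
    close : ∀ m n → ℤ.+ 1 ℚ./ suc n ℚ.< ε → √-seq a m ℚ.- √-seq a n ℚ.< ε
    close m n lt = begin-strict
      √-seq a m ℚ.- √-seq a n
        <⟨ ℚ.+-monoˡ-< (ℚ.- √-seq a n) (√-step a m n) ⟩
      (√-seq a n ℚ.+ (ℤ.+ 1 ℚ./ suc n)) ℚ.- √-seq a n
        ≡⟨ solve 2 (λ x y → (x :+ y) :- x := y) refl (√-seq a n) (ℤ.+ 1 ℚ./ suc n) ⟩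
      ℤ.+ 1 ℚ./ suc n
        <⟨ lt ⟩
      ε ∎
      where open ℚ.≤-Reasoning

√ : ℕ → ℝ
√ a = mkℝ (√-seq a) (√Properties.√-cauchy a)

+-0-rawMonoid : RawMonoid 0ℓ 0ℓ
+-0-rawMonoid = record { _≈_ = _≈ℝ_ ; _∙_ = _+ℝ_ ; ε = fromℕ 0 }

open RawMonoidDefs +-0-rawMonoid using () renaming (sum to ∑) public
open RawMonoidDefs ℕ.+-0-rawMonoid using () renaming (sum to ∑ℕ) public

------------------------------------------------------------------------
-- Graphs

-- A finite directed multigraph, given by its adjacency matrix: A i j is the
-- number of edges from i to j. In particular a loop contributes 1 to the
-- diagonal entry and to the degree.
Graph : ℕ → Set
Graph n = Fin n → Fin n → ℕ

Undirected : ∀ {n} → Graph n → Set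
Undirected A = ∀ i j → A i j ≡ A j i

Regular : ∀ {n} → ℕ → Graph n → Set
Regular k A = ∀ i → ∑ℕ (A i) ≡ k

-- The adjacency matrix of an undirected graph is real symmetric, so it is
-- enough to speak of real eigenvalues.
IsEigenvalue : ∀ {n} → Graph n → ℝ → Set
IsEigenvalue {n} A l = Σ[ v ∈ Vector ℝ n ]
  ¬ (∀ i → v i ≈ℝ fromℕ 0) ×
  (∀ i → ∑ (λ j → fromℕ (A i j) *ℝ v j) ≈ℝ l *ℝ v i)

-- k ∸ 1 is truncated only for the edgeless case k = 0.
Ramanujan : ∀ {n} → Graph n → Set
Ramanujan A = Σ[ k ∈ ℕ ]
  Undirected A × Regular k A ×
  (∀ l → IsEigenvalue A l → ¬ (∣ l ∣ℝ ≈ℝ fromℕ k) → ∣ l ∣ℝ ≤ℝ fromℕ 2 *ℝ √ (k ℕ.∸ 1))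

------------------------------------------------------------------------
-- Finite fields

IsPrimePower : ℕ → Set
IsPrimePower q = Σ[ p ∈ ℕ ] Σ[ n ∈ ℕ ] Prime p × 1 ℕ.≤ n × q ≡ p ℕ.^ n

-- A field with q elements. Heyting fields are nontrivial: if 1# ≈ 0# then
-- invertible⇒# would give 0# # 0#. Finiteness makes _≈_ decidable, so x # y
-- is equivalent to ¬ (x ≈ y).
record FiniteField (q : ℕ) (c ℓ₁ ℓ₂ : Level) : Set (lsuc (c ⊔ ℓ₁ ⊔ ℓ₂)) where
  field
    heytingField : HeytingField c ℓ₁ ℓ₂

  open HeytingField heytingField public

  field
    enumeration : Inverse (≡.setoid (Fin q)) setoid

  open Inverse enumeration public
    using () renaming (to to element; from to index; from-cong to index-cong;
                       strictlyInverseˡ to element∘index; strictlyInverseʳ to index∘element)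

  infix 4 _≈?_

  _≈?_ : ∀ x y → Dec (x ≈ y)
  x ≈? y = map′
    (λ eq → trans (sym (element∘index x))
              (trans (reflexive (≡.cong element eq)) (element∘index y)))
    index-cong
    (index x Fin.≟ index y)

  commutativeRing : CommutativeRing c ℓ₁
  commutativeRing = HeytingCommutativeRing.commutativeRing heytingCommutativeRing

  open SemiringExp (CommutativeRing.semiring commutativeRing) public using (_^_)

  NonzeroSquare : Carrier → Set (c ⊔ ℓ₁)
  NonzeroSquare s = Σ[ x ∈ Carrier ] ¬ (x ≈ 0#) × s ≈ x * x

  nonzeroSquare? : ∀ s → Dec (NonzeroSquare s)
  nonzeroSquare? s = map′
    (λ (i , i≉0 , eq) → element i , i≉0 , eq)
    (λ (x , x≉0 , eq) → index x
      , (λ h → x≉0 (trans (sym (element∘index x)) h))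
      , trans eq (*-cong (sym (element∘index x)) (sym (element∘index x))))
    (Fin.any? (λ i → ¬? (element i ≈? 0#) ×-dec (s ≈? (element i * element i))))

  -- The graph with vertex set the field (via the enumeration) and one edge
  -- from x to f s x for each nonzero square s.
  edges : (Carrier → Carrier → Carrier) → Graph q
  edges f i j = count
    (λ s → nonzeroSquare? (element s) ×-dec (f (element s) (element i) ≈? element j))
    (allFin q)

module _ {q c ℓ₁ ℓ₂} (F : FiniteField q c ℓ₁ ℓ₂) where
  open FiniteField F using (Carrier; edges; _+_; -_; _^_)

  PaleySum : Graph q
  PaleySum = edges (λ s x → - x + s)

  TwistedPaley : (Carrier → Carrier) → Graph q
  TwistedPaley σ = edges (λ s x → σ (x + s))

  TwistedPaleySum : (Carrier → Carrier) → Graph q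
  TwistedPaleySum σ = edges (λ s x → σ (- x + s))

  power : ℕ → Carrier → Carrier
  power m x = x ^ m

module Submission where

-- A graph of the theorem has an edge from x to y exactly if τ y + ρ x ∈ Q, for bijections τ and ρ of
-- the field. With S x y = χ (τ y + ρ x), χ the quadratic character, J the all-ones matrix and M the
-- permutation matrix of the relation τ y + ρ x = 0, the adjacency matrix A satisfies 2A = S + J - M.
-- The Jacobsthal sums give Sᵀ S = q I - J, so every vector w satisfies
--   |2A w - J w|² = |S w - M w|² ≤ 2 |S w|² + 2 |M w|² ≤ (2q + 2) |w|².
-- An eigenvector v for l with |l| ≠ k has coordinate sum 0, hence 4 l² ≤ 2q + 2 = 4k + 4, which for
-- k = (q - 1) / 2 ≥ 2 is less than 16 (k - 1). The inequality for w is proved over ℚ and applied to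
-- the rational approximations of v.

open import Algebra.Bundles using (CommutativeMonoid; CommutativeRing)
import Algebra.Properties.CommutativeMonoid.Sum as CommutativeMonoidSum
import Algebra.Properties.CommutativeSemigroup as CommutativeSemigroupProperties
import Algebra.Properties.CommutativeSemiring.Binomial as CommutativeSemiringBinomial
import Algebra.Properties.CommutativeSemiring.Exp as CommutativeSemiringExp
import Algebra.Properties.Ring as RingProperties
import Algebra.Properties.Semiring.Mult as SemiringMult
import Algebra.Properties.Semiring.Sum as SemiringSum
open import Data.Fin.Base as Fin using (Fin; zero; suc; inject₁; punchIn; toℕ)
import Data.Fin.Permutation as Perm
import Data.Fin.Properties as Fin
import Data.Integer.Base as ℤ
import Data.Integer.Properties as ℤ
open import Data.Nat.Base as ℕ using (ℕ; zero; suc)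
import Data.Nat.Combinatorics as ℕ
import Data.Nat.Divisibility as ℕ
import Data.Nat.DivMod as ℕ
open import Data.Nat.Primality using (Prime; euclidsLemma; prime⇒nonTrivial; prime⇒nonZero)
import Data.Nat.Properties as ℕ
import Data.Nat.Tactic.RingSolver as ℕ-Ring
open import Data.Product.Base using (Σ-syntax; ∃; _×_; _,_; proj₁; proj₂)
open import Data.Rational.Base as ℚ using (ℚ; 0ℚ; 1ℚ)
import Data.Rational.Properties as ℚ
import Data.Rational.Solver as ℚ-Solver
import Data.Rational.Unnormalised.Base as ℚᵘ
import Data.Rational.Unnormalised.Properties as ℚᵘ
open import Data.Sum.Base as Sum using (_⊎_; inj₁; inj₂)
open import Data.Vec.Base using (count; allFin; tabulate)
open import Data.Vec.Functional using (Vector)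
open import Defs using
  ( Eventually; Cauchy; module CauchyProperties; module √Properties
  ; ℝ; seq; cauchy; fromℕ; isqrt; isqrt-upper; √; √-seq; ∑; ∑ℕ; ∣_∣ℝ; _≈ℝ_; _≤ℝ_; _*ℝ_
  ; Graph; Undirected; Regular)
open import Defs using (IsPrimePower; FiniteField; Ramanujan; PaleySum; TwistedPaley; TwistedPaleySum; power)
open import Function.Base using (_∘_; id)
open import Function.Bundles using (Inverse)
open import Level using (Level; _⊔_)
open import Relation.Binary.Definitions using (tri<; tri≈; tri>)
open import Relation.Binary.PropositionalEquality as ≡ using (_≡_; refl)
import Relation.Binary.Reasoning.Setoid as SetoidReasoning
open import Relation.Nullary using (¬_; Dec; yes; no; contradiction)
open import Relation.Nullary.Decidable using (_×-dec_)
open import Relation.Unary using (Pred; Decidable)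

open CauchyProperties using
  (bounded; half-pos; half+half; split; ∣p-q∣<ε; ∣p∣-∣q∣≤∣p-q∣; m⊔n≤o⇒m≤o,n≤o)
open SemiringSum (CommutativeRing.semiring ℚ.+-*-commutativeRing)
  using (sum-cong-≗; ∑-distrib-+; ∑-comm; *-distribˡ-sum; *-distribʳ-sum)
  renaming (sum to ∑ℚ)
open ℚ-Solver.+-*-Solver using (solve; con; _:=_; _:+_; _:-_; _:*_; :-_)

-- The reals are Cauchy sequences and the logic is constructive: an eigenvector that is not zero
-- need not exhibit a coordinate apart from 0, and no case distinction on l = k is available. Two
-- facts bridge the gap: a real that is not apart from 0 equals 0, and `≤ℝ` is stable under double
-- negation. The approximations of l and v satisfy the eigenvector equation only up to errors
-- tending to 0; since 4k + 4 < 16 (k - 1) is a strict inequality of naturals, it leaves a gap of at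
-- least |w|² that absorbs them. The triangle inequality would give 2 |l| ≤ √q + 1; the weaker
-- estimate by doubled squares stays rational, and (√q + 1)² ≤ 2q + 2 loses little. The congruence q
-- ≡ 1 mod 4 makes 2 nonzero in the field, rules out q = 3 and makes -1 a square. The last fact is
-- what makes the twisted Paley graph undirected. It comes from the number N of pairs t, 1 + t of
-- nonzero squares, for which 4N + 2 + 2 [-1 ∈ Q] = q - 1.

private variable
  ℓp ℓq : Level
  P : Set ℓp
  Q : Set ℓq
  n : ℕ

-- Finite sums, indicators and quadratic forms over ℚ

module _ {a ℓ} (M : CommutativeMonoid a ℓ) where
  open CommutativeMonoid M using (Carrier; _≈_; ε; ∙-congˡ; identityʳ; trans)
  open CommutativeMonoidSum M using (sum; sum-remove; sum-cong-≋; sum-replicate-zero)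

  -- Serves two monoids: sums over ℚ weighted by a Kronecker delta, and a product in the field whose
  -- factors are all 1 except one.
  sum-single : (k : Fin n) (t : Fin n → Carrier) → (∀ j → ¬ (j ≡ k) → t j ≈ ε) → sum t ≈ t k
  sum-single {suc n} k t vanish = trans (sum-remove {i = k} t) (trans (∙-congˡ (trans
    (sum-cong-≋ λ j → vanish (punchIn k j) (Fin.punchInᵢ≢i k j)) (sum-replicate-zero n))) (identityʳ (t k)))

ι : ℕ → ℚ
ι a = ℤ.+ a ℚ./ 1

ι-+ : ∀ a b → ι (a ℕ.+ b) ≡ ι a ℚ.+ ι b
ι-+ a b = √Properties.frac-+ a b 0

ι-mono-< : ∀ {a b} → a ℕ.< b → ι a ℚ.< ι b
ι-mono-< {a} {b} a<b =
  √Properties.frac-< a b 0 0 (≡.subst₂ ℕ._<_ (≡.sym (ℕ.*-identityʳ a)) (≡.sym (ℕ.*-identityʳ b)) a<b)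

ι-injective : ∀ {a b} → ι a ≡ ι b → a ≡ b
ι-injective {a} {b} eq with ℕ.<-cmp a b
... | tri< a<b _ _ = contradiction (ι-mono-< a<b) (ℚ.<-irrefl eq)
... | tri≈ _ a≡b _ = a≡b
... | tri> _ _ b<a = contradiction (ι-mono-< b<a) (ℚ.<-irrefl (≡.sym eq))

/-*-ι : ∀ a n → (ℤ.+ a ℚ./ suc n) ℚ.* ι (suc n) ≡ ι a
/-*-ι a n = ℚ.toℚᵘ-injective (begin
  ℚ.toℚᵘ ((ℤ.+ a ℚ./ suc n) ℚ.* ι (suc n))
    ≈⟨ ℚ.toℚᵘ-homo-* (ℤ.+ a ℚ./ suc n) (ι (suc n)) ⟩
  ℚ.toℚᵘ (ℤ.+ a ℚ./ suc n) ℚᵘ.* ℚ.toℚᵘ (ι (suc n))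
    ≈⟨ ℚᵘ.*-cong (ℚ.toℚᵘ-fromℚᵘ (ℚᵘ.mkℚᵘ (ℤ.+ a) n)) (ℚ.toℚᵘ-fromℚᵘ (ℚᵘ.mkℚᵘ (ℤ.+ suc n) 0)) ⟩
  ℚᵘ.mkℚᵘ (ℤ.+ a) n ℚᵘ.* ℚᵘ.mkℚᵘ (ℤ.+ suc n) 0
    ≈⟨ ℚᵘ.*≡* (≡.trans (ℤ.*-identityʳ _)
         (≡.cong (λ m → ℤ.+ a ℤ.* ℤ.+ m) (≡.sym (ℕ.*-identityʳ (suc n))))) ⟩
  ℚᵘ.mkℚᵘ (ℤ.+ a) 0
    ≈⟨ ℚᵘ.≃-sym (ℚ.toℚᵘ-fromℚᵘ (ℚᵘ.mkℚᵘ (ℤ.+ a) 0)) ⟩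
  ℚ.toℚᵘ (ι a) ∎)
  where open ℚᵘ.≃-Reasoning

ι-* : ∀ a b → ι (a ℕ.* b) ≡ ι a ℚ.* ι b
ι-* zero    b = ≡.sym (ℚ.*-zeroˡ (ι b))
ι-* (suc a) b = begin
  ι (b ℕ.+ a ℕ.* b)       ≡⟨ ι-+ b (a ℕ.* b) ⟩
  ι b ℚ.+ ι (a ℕ.* b)     ≡⟨ ≡.cong (ι b ℚ.+_) (ι-* a b) ⟩
  ι b ℚ.+ ι a ℚ.* ι b     ≡⟨ solve 2 (λ x y → y :+ x :* y := (con 1ℚ :+ x) :* y) refl (ι a) (ι b) ⟩
  (1ℚ ℚ.+ ι a) ℚ.* ι b    ≡⟨ ≡.cong (ℚ._* ι b) (≡.sym (ι-+ 1 a)) ⟩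
  ι (suc a) ℚ.* ι b       ∎
  where open ≡.≡-Reasoning

ι-∑ : (f : Fin n → ℕ) → ι (∑ℕ f) ≡ ∑ℚ (ι ∘ f)
ι-∑ {zero}  f = refl
ι-∑ {suc n} f = ≡.trans (ι-+ (f zero) _) (≡.cong (ι (f zero) ℚ.+_) (ι-∑ (f ∘ suc)))

∑-const : ∀ n c → ∑ℚ {n} (λ _ → c) ≡ ι n ℚ.* c
∑-const zero    c = ≡.sym (ℚ.*-zeroˡ c)
∑-const (suc n) c = begin
  c ℚ.+ ∑ℚ {n} (λ _ → c) ≡⟨ ≡.cong (c ℚ.+_) (∑-const n c) ⟩
  c ℚ.+ ι n ℚ.* c        ≡⟨ solve 2 (λ x y → y :+ x :* y := (con 1ℚ :+ x) :* y) refl (ι n) c ⟩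
  (1ℚ ℚ.+ ι n) ℚ.* c     ≡⟨ ≡.cong (ℚ._* c) (≡.sym (ι-+ 1 n)) ⟩
  ι (suc n) ℚ.* c        ∎
  where open ≡.≡-Reasoning

∑-mono-≤ : {f g : Fin n → ℚ} → (∀ i → f i ℚ.≤ g i) → ∑ℚ f ℚ.≤ ∑ℚ g
∑-mono-≤ {zero}  f≤g = ℚ.≤-refl
∑-mono-≤ {suc n} f≤g = ℚ.+-mono-≤ (f≤g zero) (∑-mono-≤ (f≤g ∘ suc))

∑-nonPos : {f : Fin n → ℚ} → (∀ i → f i ℚ.≤ 0ℚ) → ∑ℚ f ℚ.≤ 0ℚ
∑-nonPos {n} {f} f≤0 = ℚ.≤-trans (∑-mono-≤ f≤0) (ℚ.≤-reflexive (≡.trans (∑-const n 0ℚ) (ℚ.*-zeroʳ (ι n))))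

-- The tail is nonpositive, so a zero total forces the head to be nonnegative as well. One identity
-- between sums thus becomes an identity for each summand, which is how `χ` is evaluated at a
-- product with a nonsquare.
∑-nonPos-zero : {f : Fin n → ℚ} → (∀ i → f i ℚ.≤ 0ℚ) → ∑ℚ f ≡ 0ℚ → ∀ i → f i ≡ 0ℚ
∑-nonPos-zero {suc n} {f} f≤0 eq = go
  where
  open ℚ.≤-Reasoning
  rest = ∑-nonPos (f≤0 ∘ suc)
  head≥0 : 0ℚ ℚ.≤ f zero
  head≥0 = begin
    0ℚ                      ≡⟨ ≡.sym eq ⟩
    f zero ℚ.+ ∑ℚ (f ∘ suc) ≤⟨ ℚ.+-monoʳ-≤ (f zero) rest ⟩
    f zero ℚ.+ 0ℚ           ≡⟨ ℚ.+-identityʳ (f zero) ⟩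
    f zero                  ∎
  head≡0 = ℚ.≤-antisym (f≤0 zero) head≥0
  go : ∀ i → f i ≡ 0ℚ
  go zero    = head≡0
  go (suc i) = ∑-nonPos-zero (f≤0 ∘ suc)
    (≡.trans (≡.sym (≡.trans (≡.cong (ℚ._+ ∑ℚ (f ∘ suc)) head≡0) (ℚ.+-identityˡ _))) eq) i

𝟏 : Dec P → ℚ
𝟏 (yes _) = 1ℚ
𝟏 (no  _) = 0ℚ

𝟏-true : (P? : Dec P) → P → 𝟏 P? ≡ 1ℚ
𝟏-true (yes _) p = refl
𝟏-true (no ¬p) p = contradiction p ¬p

𝟏-false : (P? : Dec P) → ¬ P → 𝟏 P? ≡ 0ℚ
𝟏-false (yes p) ¬p = contradiction p ¬p
𝟏-false (no _)  ¬p = refl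

𝟏-cong : (P? : Dec P) (Q? : Dec Q) → (P → Q) → (Q → P) → 𝟏 P? ≡ 𝟏 Q?
𝟏-cong (yes p) Q? to from = ≡.sym (𝟏-true Q? (to p))
𝟏-cong (no ¬p) Q? to from = ≡.sym (𝟏-false Q? (¬p ∘ from))

𝟏-×-dec : (P? : Dec P) (Q? : Dec Q) → 𝟏 (P? ×-dec Q?) ≡ 𝟏 P? ℚ.* 𝟏 Q?
𝟏-×-dec (yes _) (yes _) = refl
𝟏-×-dec (yes _) (no _)  = refl
𝟏-×-dec (no _)  Q?      = ≡.sym (ℚ.*-zeroˡ (𝟏 Q?))

ι-count : ∀ {a p} {A : Set a} {P : Pred A p} (P? : Decidable P) (f : Fin n → A) →
  ι (count P? (tabulate f)) ≡ ∑ℚ (λ i → 𝟏 (P? (f i)))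
ι-count {n = zero}  P? f = refl
ι-count {n = suc n} P? f with P? (f zero)
... | yes _ = ≡.trans (ι-+ 1 (count P? (tabulate (f ∘ suc)))) (≡.cong (1ℚ ℚ.+_) (ι-count P? (f ∘ suc)))
... | no  _ = ≡.trans (ι-count P? (f ∘ suc)) (≡.sym (ℚ.+-identityˡ _))

∑-𝟏 : (k : Fin n) (g : Fin n → ℚ) → ∑ℚ (λ i → 𝟏 (i Fin.≟ k) ℚ.* g i) ≡ g k
∑-𝟏 k g = ≡.trans
  (sum-single ℚ.+-0-commutativeMonoid k (λ i → 𝟏 (i Fin.≟ k) ℚ.* g i)
    (λ j j≢k → ≡.trans (≡.cong (ℚ._* g j) (𝟏-false (j Fin.≟ k) j≢k)) (ℚ.*-zeroˡ (g j))))
  (≡.trans (≡.cong (ℚ._* g k) (𝟏-true (k Fin.≟ k) refl)) (ℚ.*-identityˡ (g k)))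

∑-neg : (f : Fin n → ℚ) → ∑ℚ (λ i → ℚ.- f i) ≡ ℚ.- ∑ℚ f
∑-neg {zero}  f = refl
∑-neg {suc n} f = ≡.trans (≡.cong (ℚ.- f zero ℚ.+_) (∑-neg (f ∘ suc)))
  (≡.sym (ℚ.neg-distrib-+ (f zero) (∑ℚ (f ∘ suc))))

∑-distrib-sub : (f g : Fin n → ℚ) → ∑ℚ (λ i → f i ℚ.- g i) ≡ ∑ℚ f ℚ.- ∑ℚ g
∑-distrib-sub f g = ≡.trans (∑-distrib-+ f (λ i → ℚ.- g i)) (≡.cong (∑ℚ f ℚ.+_) (∑-neg g))

square-nonNeg : ∀ x → 0ℚ ℚ.≤ x ℚ.* x
square-nonNeg x with ℚ.≤-total 0ℚ x
... | inj₁ 0≤x = ℚ.nonNegative⁻¹ (x ℚ.* x)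
  {{ℚ.nonNeg*nonNeg⇒nonNeg x {{ℚ.nonNegative 0≤x}} x {{ℚ.nonNegative 0≤x}}}}
... | inj₂ x≤0 = ℚ.nonNegative⁻¹ (x ℚ.* x)
  {{ℚ.nonPos*nonPos⇒nonPos x {{ℚ.nonPositive x≤0}} x {{ℚ.nonPositive x≤0}}}}

-- Expands |s w|² as the quadratic form of sᵀ s, here α I - β J. It is applied to the character
-- matrix with (q, 1) and to the permutation matrix with (1, 0).
gram : ∀ {m n} (s : Fin m → Fin n → ℚ) (w : Fin n → ℚ) α β →
  (∀ j k → ∑ℚ (λ i → s i j ℚ.* s i k) ≡ α ℚ.* 𝟏 (j Fin.≟ k) ℚ.- β) →
  ∑ℚ (λ i → ∑ℚ (λ j → s i j ℚ.* w j) ℚ.* ∑ℚ (λ j → s i j ℚ.* w j))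
    ≡ α ℚ.* ∑ℚ (λ j → w j ℚ.* w j) ℚ.- β ℚ.* (∑ℚ w ℚ.* ∑ℚ w)
gram {m} {n} s w α β G = begin
  ∑ℚ (λ i → ∑ℚ (λ j → s i j ℚ.* w j) ℚ.* ∑ℚ (λ j → s i j ℚ.* w j))
    ≡⟨ sum-cong-≗ expand ⟩
  ∑ℚ (λ i → ∑ℚ (λ j → ∑ℚ (λ k → s i j ℚ.* s i k ℚ.* (w j ℚ.* w k))))
    ≡⟨ ∑-comm (λ i j → ∑ℚ (λ k → s i j ℚ.* s i k ℚ.* (w j ℚ.* w k))) ⟩
  ∑ℚ (λ j → ∑ℚ (λ i → ∑ℚ (λ k → s i j ℚ.* s i k ℚ.* (w j ℚ.* w k))))
    ≡⟨ sum-cong-≗ inner ⟩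
  ∑ℚ (λ j → α ℚ.* (w j ℚ.* w j) ℚ.- β ℚ.* ∑ℚ w ℚ.* w j)
    ≡⟨ ∑-distrib-sub (λ j → α ℚ.* (w j ℚ.* w j)) (λ j → β ℚ.* ∑ℚ w ℚ.* w j) ⟩
  ∑ℚ (λ j → α ℚ.* (w j ℚ.* w j)) ℚ.- ∑ℚ (λ j → β ℚ.* ∑ℚ w ℚ.* w j)
    ≡⟨ ≡.cong₂ ℚ._-_ (≡.sym (*-distribˡ-sum α (λ j → w j ℚ.* w j)))
         (≡.trans (≡.sym (*-distribˡ-sum (β ℚ.* ∑ℚ w) w)) (ℚ.*-assoc β (∑ℚ w) (∑ℚ w))) ⟩
  α ℚ.* ∑ℚ (λ j → w j ℚ.* w j) ℚ.- β ℚ.* (∑ℚ w ℚ.* ∑ℚ w) ∎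
  where
  open ≡.≡-Reasoning
  expand : ∀ i → ∑ℚ (λ j → s i j ℚ.* w j) ℚ.* ∑ℚ (λ j → s i j ℚ.* w j)
    ≡ ∑ℚ (λ j → ∑ℚ (λ k → s i j ℚ.* s i k ℚ.* (w j ℚ.* w k)))
  expand i = ≡.trans (*-distribʳ-sum (∑ℚ (λ j → s i j ℚ.* w j)) (λ j → s i j ℚ.* w j))
    (sum-cong-≗ λ j → ≡.trans (*-distribˡ-sum (s i j ℚ.* w j) (λ k → s i k ℚ.* w k))
    (sum-cong-≗ λ k → solve 4 (λ a b c d → (a :* b) :* (c :* d) := (a :* c) :* (b :* d)) refl
      (s i j) (w j) (s i k) (w k)))
  entry : ∀ j k → ∑ℚ (λ i → s i j ℚ.* s i k ℚ.* (w j ℚ.* w k))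
    ≡ 𝟏 (k Fin.≟ j) ℚ.* (α ℚ.* (w j ℚ.* w k)) ℚ.- β ℚ.* w j ℚ.* w k
  entry j k = begin
    ∑ℚ (λ i → s i j ℚ.* s i k ℚ.* (w j ℚ.* w k))
      ≡⟨ ≡.sym (*-distribʳ-sum (w j ℚ.* w k) (λ i → s i j ℚ.* s i k)) ⟩
    ∑ℚ (λ i → s i j ℚ.* s i k) ℚ.* (w j ℚ.* w k)
      ≡⟨ ≡.cong (ℚ._* (w j ℚ.* w k)) (G j k) ⟩
    (α ℚ.* 𝟏 (j Fin.≟ k) ℚ.- β) ℚ.* (w j ℚ.* w k)
      ≡⟨ ≡.cong (λ t → (α ℚ.* t ℚ.- β) ℚ.* (w j ℚ.* w k)) (𝟏-cong (j Fin.≟ k) (k Fin.≟ j) ≡.sym ≡.sym) ⟩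
    (α ℚ.* 𝟏 (k Fin.≟ j) ℚ.- β) ℚ.* (w j ℚ.* w k)
      ≡⟨ solve 5 (λ a d b x y → (a :* d :- b) :* (x :* y) := d :* (a :* (x :* y)) :- b :* x :* y) refl
           α (𝟏 (k Fin.≟ j)) β (w j) (w k) ⟩
    𝟏 (k Fin.≟ j) ℚ.* (α ℚ.* (w j ℚ.* w k)) ℚ.- β ℚ.* w j ℚ.* w k ∎
  inner : ∀ j → ∑ℚ (λ i → ∑ℚ (λ k → s i j ℚ.* s i k ℚ.* (w j ℚ.* w k)))
    ≡ α ℚ.* (w j ℚ.* w j) ℚ.- β ℚ.* ∑ℚ w ℚ.* w j
  inner j = begin
    ∑ℚ (λ i → ∑ℚ (λ k → s i j ℚ.* s i k ℚ.* (w j ℚ.* w k)))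
      ≡⟨ ∑-comm (λ i k → s i j ℚ.* s i k ℚ.* (w j ℚ.* w k)) ⟩
    ∑ℚ (λ k → ∑ℚ (λ i → s i j ℚ.* s i k ℚ.* (w j ℚ.* w k)))
      ≡⟨ sum-cong-≗ (entry j) ⟩
    ∑ℚ (λ k → 𝟏 (k Fin.≟ j) ℚ.* (α ℚ.* (w j ℚ.* w k)) ℚ.- β ℚ.* w j ℚ.* w k)
      ≡⟨ ∑-distrib-sub (λ k → 𝟏 (k Fin.≟ j) ℚ.* (α ℚ.* (w j ℚ.* w k))) (λ k → β ℚ.* w j ℚ.* w k) ⟩
    ∑ℚ (λ k → 𝟏 (k Fin.≟ j) ℚ.* (α ℚ.* (w j ℚ.* w k))) ℚ.- ∑ℚ (λ k → β ℚ.* w j ℚ.* w k)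
      ≡⟨ ≡.cong₂ ℚ._-_ (∑-𝟏 j (λ k → α ℚ.* (w j ℚ.* w k))) (≡.sym (*-distribˡ-sum (β ℚ.* w j) w)) ⟩
    α ℚ.* (w j ℚ.* w j) ℚ.- β ℚ.* w j ℚ.* ∑ℚ w
      ≡⟨ ≡.cong (λ t → α ℚ.* (w j ℚ.* w j) ℚ.- t)
           (solve 3 (λ b x y → b :* x :* y := b :* y :* x) refl β (w j) (∑ℚ w)) ⟩
    α ℚ.* (w j ℚ.* w j) ℚ.- β ℚ.* ∑ℚ w ℚ.* w j ∎

-- Rational sequences and real numbers

module _ {P Q : ℕ → Set} where
  eventually-map : (∀ n → P n → Q n) → Eventually P → Eventually Q
  eventually-map f (N , p) = N , λ n N≤n → f n (p n N≤n)

  eventually-× : Eventually P → Eventually Q → Eventually (λ n → P n × Q n)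
  eventually-× (M , p) (N , q) = M ℕ.⊔ N , λ n le →
    let M≤n , N≤n = m⊔n≤o⇒m≤o,n≤o M N le in p n M≤n , q n N≤n

-- For a Cauchy sequence, `Null` is equality with 0 in ℝ and `Apart` is the positive form of being
-- nonzero. Bare sequences are used so that error terms can be estimated without proving them
-- Cauchy.
Null Bounded Apart : (ℕ → ℚ) → Set
Null x    = ∀ ε → 0ℚ ℚ.< ε → Eventually λ n → ℚ.∣ x n ∣ ℚ.< ε
Bounded x = Σ[ B ∈ ℚ ] (0ℚ ℚ.< B × Eventually λ n → ℚ.∣ x n ∣ ℚ.< B)
Apart x   = Σ[ δ ∈ ℚ ] (0ℚ ℚ.< δ × Eventually λ n → δ ℚ.< ℚ.∣ x n ∣)

*-mono-≤-nonNeg : ∀ {a b c d} → 0ℚ ℚ.≤ b → 0ℚ ℚ.≤ c → a ℚ.≤ b → c ℚ.≤ d → a ℚ.* c ℚ.≤ b ℚ.* d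
*-mono-≤-nonNeg {a} {b} {c} {d} 0≤b 0≤c a≤b c≤d = ℚ.≤-trans
  (ℚ.*-monoʳ-≤-nonNeg c {{ℚ.nonNegative 0≤c}} a≤b)
  (ℚ.*-monoˡ-≤-nonNeg b {{ℚ.nonNegative 0≤b}} c≤d)

square-cancel-< : ∀ {x y} → 0ℚ ℚ.≤ y → x ℚ.* x ℚ.< y ℚ.* y → x ℚ.< y
square-cancel-< {x} {y} 0≤y lt with x ℚ.<? y
... | yes x<y = x<y
... | no  x≮y = let y≤x = ℚ.≮⇒≥ x≮y in contradiction
  (ℚ.<-≤-trans lt (*-mono-≤-nonNeg (ℚ.≤-trans 0≤y y≤x) 0≤y y≤x y≤x)) (ℚ.<-irrefl refl)

∣p∣*∣p∣≡p*p : ∀ p → ℚ.∣ p ∣ ℚ.* ℚ.∣ p ∣ ≡ p ℚ.* p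
∣p∣*∣p∣≡p*p p = ≡.trans (≡.sym (ℚ.∣p*q∣≡∣p∣*∣q∣ p p)) (ℚ.0≤p⇒∣p∣≡p (square-nonNeg p))

+-cancelʳ-< : ∀ {p q r} → p ℚ.+ r ℚ.< q ℚ.+ r → p ℚ.< q
+-cancelʳ-< {p} {q} {r} lt = ≡.subst₂ ℚ._<_ (cancel p r) (cancel q r) (ℚ.+-monoˡ-< (ℚ.- r) lt)
  where
  cancel : ∀ p r → (p ℚ.+ r) ℚ.- r ≡ p
  cancel = solve 2 (λ p r → (p :+ r) :- r := p) refl

p≤∣p∣ : ∀ p → p ℚ.≤ ℚ.∣ p ∣
p≤∣p∣ p with ℚ.≤-total 0ℚ p
... | inj₁ 0≤p = ℚ.≤-reflexive (≡.sym (ℚ.0≤p⇒∣p∣≡p 0≤p))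
... | inj₂ p≤0 = ℚ.≤-trans p≤0 (ℚ.0≤∣p∣ p)

half-< : ∀ {ε} → 0ℚ ℚ.< ε → ε ℚ.* ℚ.½ ℚ.< ε
half-< {ε} ε>0 = ≡.subst₂ ℚ._<_ (ℚ.+-identityʳ (ε ℚ.* ℚ.½)) (half+half ε)
  (ℚ.+-monoʳ-< (ε ℚ.* ℚ.½) (half-pos ε>0))

module _ {x y : ℕ → ℚ} where
  Null-cong : (∀ n → x n ≡ y n) → Null x → Null y
  Null-cong x≗y null ε ε>0 = eventually-map (λ n → ≡.subst (λ t → ℚ.∣ t ∣ ℚ.< ε) (x≗y n)) (null ε ε>0)

  Null-+ : Null x → Null y → Null (λ n → x n ℚ.+ y n)
  Null-+ nx ny ε ε>0 = eventually-map
    (λ n (x<h , y<h) → ℚ.≤-<-trans (ℚ.∣p+q∣≤∣p∣+∣q∣ (x n) (y n))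
      (≡.subst (ℚ.∣ x n ∣ ℚ.+ ℚ.∣ y n ∣ ℚ.<_) (half+half ε) (ℚ.+-mono-< x<h y<h)))
    (eventually-× (nx _ (half-pos ε>0)) (ny _ (half-pos ε>0)))

  Null-* : Null x → Bounded y → Null (λ n → x n ℚ.* y n)
  -- The second summand of B δ + 1 δ = ε is there to make δ B strictly smaller than ε.
  Null-* nx (B , B>0 , y<B) ε ε>0 with split B 1ℚ ε B>0 (ℚ.positive⁻¹ 1ℚ) ε>0
  ... | δ , δ>0 , eq = eventually-map
    (λ n (x<δ , y<B) → begin-strict
      ℚ.∣ x n ℚ.* y n ∣          ≡⟨ ℚ.∣p*q∣≡∣p∣*∣q∣ (x n) (y n) ⟩
      ℚ.∣ x n ∣ ℚ.* ℚ.∣ y n ∣    ≤⟨ *-mono-≤-nonNeg (ℚ.<⇒≤ δ>0) (ℚ.0≤∣p∣ (y n)) (ℚ.<⇒≤ x<δ) (ℚ.<⇒≤ y<B) ⟩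
      δ ℚ.* B                    ≡⟨ ≡.sym (ℚ.+-identityʳ (δ ℚ.* B)) ⟩
      δ ℚ.* B ℚ.+ 0ℚ             <⟨ ℚ.+-monoʳ-< (δ ℚ.* B) δ>0 ⟩
      δ ℚ.* B ℚ.+ δ              ≡⟨ solve 2 (λ d b → d :* b :+ d := b :* d :+ con 1ℚ :* d) refl δ B ⟩
      B ℚ.* δ ℚ.+ 1ℚ ℚ.* δ       ≡⟨ eq ⟩
      ε                          ∎)
    (eventually-× (nx δ δ>0) y<B)
    where open ℚ.≤-Reasoning

  Null-cancel : Apart y → Null (λ n → x n ℚ.* y n) → Null x
  Null-cancel (δ , δ>0 , y>δ) nxy ε ε>0 = eventually-map
    (λ n (xy<εδ , δ<y) → ℚ.*-cancelʳ-<-nonNeg δ {{ℚ.nonNegative (ℚ.<⇒≤ δ>0)}} (begin-strict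
      ℚ.∣ x n ∣ ℚ.* δ             ≤⟨ ℚ.*-monoˡ-≤-nonNeg ℚ.∣ x n ∣ {{ℚ.∣-∣-nonNeg (x n)}} (ℚ.<⇒≤ δ<y) ⟩
      ℚ.∣ x n ∣ ℚ.* ℚ.∣ y n ∣     ≡⟨ ≡.sym (ℚ.∣p*q∣≡∣p∣*∣q∣ (x n) (y n)) ⟩
      ℚ.∣ x n ℚ.* y n ∣           <⟨ xy<εδ ⟩
      ε ℚ.* δ                     ∎))
    (eventually-× (nxy (ε ℚ.* δ) εδ>0) y>δ)
    where
    open ℚ.≤-Reasoning
    εδ>0 : 0ℚ ℚ.< ε ℚ.* δ
    εδ>0 = ℚ.positive⁻¹ (ε ℚ.* δ) {{ℚ.pos*pos⇒pos ε {{ℚ.positive ε>0}} δ {{ℚ.positive δ>0}}}}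

module _ {x : ℕ → ℚ} where
  Null-neg : Null x → Null (λ n → ℚ.- x n)
  Null-neg nx ε ε>0 = eventually-map (λ n → ≡.subst (ℚ._< ε) (≡.sym (ℚ.∣-p∣≡∣p∣ (x n)))) (nx ε ε>0)

  Null⇒Bounded : Null x → Bounded x
  Null⇒Bounded nx = 1ℚ , ℚ.positive⁻¹ 1ℚ , nx 1ℚ (ℚ.positive⁻¹ 1ℚ)

  -- Comparison of rationals is decidable, so one term beyond the ε/4 modulus can be compared with
  -- ε/2. If it is smaller, all later terms stay below 3ε/4; otherwise they all exceed ε/4 and the
  -- sequence is apart from 0.
  ¬Apart⇒Null : Cauchy x → ¬ Apart x → Null x
  ¬Apart⇒Null cx ¬apart ε ε>0 with cx _ (half-pos (half-pos ε>0))
  ... | N , close with ℚ.∣ x N ∣ ℚ.<? ε ℚ.* ℚ.½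
  ...   | yes small = N , λ n N≤n → begin-strict
    ℚ.∣ x n ∣
      ≡⟨ ≡.cong ℚ.∣_∣ (solve 2 (λ a b → a := (a :- b) :+ b) refl (x n) (x N)) ⟩
    ℚ.∣ (x n ℚ.- x N) ℚ.+ x N ∣
      ≤⟨ ℚ.∣p+q∣≤∣p∣+∣q∣ (x n ℚ.- x N) (x N) ⟩
    ℚ.∣ x n ℚ.- x N ∣ ℚ.+ ℚ.∣ x N ∣
      <⟨ ℚ.+-mono-< (close n N N≤n ℕ.≤-refl) small ⟩
    ε ℚ.* ℚ.½ ℚ.* ℚ.½ ℚ.+ ε ℚ.* ℚ.½
      <⟨ ℚ.+-monoˡ-< (ε ℚ.* ℚ.½) (half-< (half-pos ε>0)) ⟩
    ε ℚ.* ℚ.½ ℚ.+ ε ℚ.* ℚ.½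
      ≡⟨ half+half ε ⟩
    ε ∎
    where open ℚ.≤-Reasoning
  ...   | no large = contradiction
    (δ , half-pos (half-pos ε>0) , N , λ n N≤n → +-cancelʳ-< {r = δ} (begin-strict
      δ ℚ.+ δ
        ≡⟨ half+half (ε ℚ.* ℚ.½) ⟩
      ε ℚ.* ℚ.½
        ≤⟨ ℚ.≮⇒≥ large ⟩
      ℚ.∣ x N ∣
        ≡⟨ ≡.cong ℚ.∣_∣ (solve 2 (λ a b → b := a :+ (b :- a)) refl (x n) (x N)) ⟩
      ℚ.∣ x n ℚ.+ (x N ℚ.- x n) ∣
        ≤⟨ ℚ.∣p+q∣≤∣p∣+∣q∣ (x n) (x N ℚ.- x n) ⟩
      ℚ.∣ x n ∣ ℚ.+ ℚ.∣ x N ℚ.- x n ∣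
        <⟨ ℚ.+-monoʳ-< ℚ.∣ x n ∣ (close N n ℕ.≤-refl N≤n) ⟩
      ℚ.∣ x n ∣ ℚ.+ δ ∎))
    ¬apart
    where
    open ℚ.≤-Reasoning
    δ = ε ℚ.* ℚ.½ ℚ.* ℚ.½

Null-∑ : {x : Fin n → ℕ → ℚ} → (∀ i → Null (x i)) → Null (λ m → ∑ℚ (λ i → x i m))
Null-∑ {zero}  nx ε ε>0 = 0 , λ _ _ → ε>0
Null-∑ {suc n} {x} nx = Null-+ {x = x zero} (nx zero) (Null-∑ {x = x ∘ suc} (nx ∘ suc))

-- One decidable comparison, with slack ε/2 at an index where both sequences have settled to within
-- ε/8, either gives the inequality up to ε from there on or refutes x ≤ y. It allows the eigenvalue
-- bound to be proved by contradiction.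
≤ℝ-stable : ∀ x y → ¬ ¬ (x ≤ℝ y) → x ≤ℝ y
≤ℝ-stable x y ¬¬x≤y ε ε>0 with cauchy x _ (half-pos (half-pos (half-pos ε>0)))
                             | cauchy y _ (half-pos (half-pos (half-pos ε>0)))
... | M , x~ | N , y~ with seq x (M ℕ.⊔ N) ℚ.<? seq y (M ℕ.⊔ N) ℚ.+ ε ℚ.* ℚ.½
...   | yes lt = L , λ n L≤n → begin-strict
  seq x n
    ≡⟨ solve 2 (λ a b → a := b :+ (a :- b)) refl (seq x n) (seq x L) ⟩
  seq x L ℚ.+ (seq x n ℚ.- seq x L)
    <⟨ ℚ.+-mono-< lt (≤∣-∣ (seq x n ℚ.- seq x L) (x~ n L (M≤ L≤n) (M≤ ℕ.≤-refl))) ⟩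
  seq y L ℚ.+ h ℚ.+ q
    ≡⟨ solve 4 (λ a b c d → b :+ c :+ d := (a :+ (b :- a)) :+ c :+ d) refl (seq y n) (seq y L) h q ⟩
  (seq y n ℚ.+ (seq y L ℚ.- seq y n)) ℚ.+ h ℚ.+ q
    <⟨ ℚ.+-monoˡ-< q (ℚ.+-monoˡ-< h (ℚ.+-monoʳ-< (seq y n)
         (≤∣-∣ (seq y L ℚ.- seq y n) (y~ L n (N≤ ℕ.≤-refl) (N≤ L≤n))))) ⟩
  (seq y n ℚ.+ q) ℚ.+ h ℚ.+ q
    ≡⟨ solve 3 (λ a b c → (a :+ c) :+ b :+ c := a :+ (b :+ (c :+ c))) refl (seq y n) h q ⟩
  seq y n ℚ.+ (h ℚ.+ (q ℚ.+ q))
    ≡⟨ ≡.cong (λ t → seq y n ℚ.+ (h ℚ.+ t)) (half+half (h ℚ.* ℚ.½)) ⟩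
  seq y n ℚ.+ (h ℚ.+ h ℚ.* ℚ.½)
    <⟨ ℚ.+-monoʳ-< (seq y n) (ℚ.+-monoʳ-< h (half-< (half-pos ε>0))) ⟩
  seq y n ℚ.+ (h ℚ.+ h)
    ≡⟨ ≡.cong (seq y n ℚ.+_) (half+half ε) ⟩
  seq y n ℚ.+ ε ∎
  where
  open ℚ.≤-Reasoning
  L = M ℕ.⊔ N
  h = ε ℚ.* ℚ.½
  q = ε ℚ.* ℚ.½ ℚ.* ℚ.½ ℚ.* ℚ.½
  ≤∣-∣ : ∀ p → ℚ.∣ p ∣ ℚ.< q → p ℚ.< q
  ≤∣-∣ p = ℚ.≤-<-trans (p≤∣p∣ p)
  M≤ : ∀ {n} → L ℕ.≤ n → M ℕ.≤ n
  M≤ = proj₁ ∘ m⊔n≤o⇒m≤o,n≤o M N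
  N≤ : ∀ {n} → L ℕ.≤ n → N ℕ.≤ n
  N≤ = proj₂ ∘ m⊔n≤o⇒m≤o,n≤o M N
...   | no ge = contradiction x≰y ¬¬x≤y
  where
  open ℚ.≤-Reasoning
  L = M ℕ.⊔ N
  h = ε ℚ.* ℚ.½
  q = ε ℚ.* ℚ.½ ℚ.* ℚ.½ ℚ.* ℚ.½
  M≤ : ∀ {n} → L ℕ.≤ n → M ℕ.≤ n
  M≤ = proj₁ ∘ m⊔n≤o⇒m≤o,n≤o M N
  N≤ : ∀ {n} → L ℕ.≤ n → N ℕ.≤ n
  N≤ = proj₂ ∘ m⊔n≤o⇒m≤o,n≤o M N
  x≰y : ¬ (x ≤ℝ y)
  -- The tolerance ε/4 and two moves of less than ε/8 together stay strictly below ε/2, the margin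
  -- by which the comparison at `L` failed.
  x≰y x≤y with x≤y _ (half-pos (half-pos ε>0))
  ... | K , x≤y′ = ℚ.<-irrefl refl (begin-strict
    seq x m                             <⟨ x≤y′ m (ℕ.m≤n⊔m L K) ⟩
    seq y m ℚ.+ h ℚ.* ℚ.½
      ≡⟨ solve 3 (λ a b c → a :+ c := (b :+ (a :- b)) :+ c) refl (seq y m) (seq y L) (h ℚ.* ℚ.½) ⟩
    (seq y L ℚ.+ (seq y m ℚ.- seq y L)) ℚ.+ h ℚ.* ℚ.½
      <⟨ ℚ.+-monoˡ-< (h ℚ.* ℚ.½) (ℚ.+-monoʳ-< (seq y L)
           (ℚ.≤-<-trans (p≤∣p∣ (seq y m ℚ.- seq y L)) (y~ m L (N≤ L≤m) (N≤ ℕ.≤-refl)))) ⟩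
    (seq y L ℚ.+ q) ℚ.+ h ℚ.* ℚ.½
      ≡⟨ ≡.cong (λ t → seq y L ℚ.+ q ℚ.+ t) (≡.sym (half+half (h ℚ.* ℚ.½))) ⟩
    (seq y L ℚ.+ q) ℚ.+ (q ℚ.+ q)
      ≡⟨ solve 2 (λ a c → (a :+ c) :+ (c :+ c) := a :+ ((c :+ c) :+ (c :+ c)) :- c) refl (seq y L) q ⟩
    seq y L ℚ.+ ((q ℚ.+ q) ℚ.+ (q ℚ.+ q)) ℚ.- q
      ≡⟨ ≡.cong (λ t → seq y L ℚ.+ t ℚ.- q)
           (≡.trans (≡.cong₂ ℚ._+_ (half+half (h ℚ.* ℚ.½)) (half+half (h ℚ.* ℚ.½))) (half+half h)) ⟩
    seq y L ℚ.+ h ℚ.- q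
      ≤⟨ ℚ.+-monoˡ-≤ (ℚ.- q) (ℚ.≮⇒≥ ge) ⟩
    seq x L ℚ.- q
      <⟨ ℚ.+-monoʳ-< (seq x L) (ℚ.neg-antimono-<
           (ℚ.≤-<-trans (p≤∣p∣ (seq x L ℚ.- seq x m)) (x~ L m (M≤ ℕ.≤-refl) (M≤ L≤m)))) ⟩
    seq x L ℚ.- (seq x L ℚ.- seq x m)
      ≡⟨ solve 2 (λ a b → a :- (a :- b) := b) refl (seq x L) (seq x m) ⟩
    seq x m ∎)
    where
    m = L ℕ.⊔ K
    L≤m = ℕ.m≤m⊔n L K

seq-∑ : (f : Vector ℝ n) → ∀ m → seq (∑ f) m ≡ ∑ℚ (λ i → seq (f i) m)
seq-∑ {zero}  f m = refl
seq-∑ {suc n} f m = ≡.cong (seq (f zero) m ℚ.+_) (seq-∑ (f ∘ suc) m)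

-- The n-th approximation to √a falls short of √a by less than 1 / suc n.
ι<√-seq² : ∀ a n → let u = √-seq a n ℚ.+ (ℤ.+ 1 ℚ./ suc n) in ι a ℚ.< u ℚ.* u
ι<√-seq² a n = ≡.subst (λ u → ι a ℚ.< u ℚ.* u)
  (≡.trans (≡.cong (λ k → ℤ.+ k ℚ./ suc n) (ℕ.+-comm 1 t)) (√Properties.frac-+ t 1 n))
  (ℚ.*-cancelʳ-<-nonNeg (ι N ℚ.* ι N) {{ℚ.nonNegative (square-nonNeg (ι N))}} (begin-strict
    ι a ℚ.* (ι N ℚ.* ι N)       ≡⟨ ≡.cong (ι a ℚ.*_) (≡.sym (ι-* N N)) ⟩
    ι a ℚ.* ι (N ℕ.* N)         ≡⟨ ≡.sym (ι-* a (N ℕ.* N)) ⟩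
    ι (a ℕ.* (N ℕ.* N))         <⟨ ι-mono-< (isqrt-upper (a ℕ.* (N ℕ.* N))) ⟩
    ι (suc t ℕ.* suc t)         ≡⟨ ι-* (suc t) (suc t) ⟩
    ι (suc t) ℚ.* ι (suc t)     ≡⟨ ≡.sym (≡.cong₂ ℚ._*_ (/-*-ι (suc t) n) (/-*-ι (suc t) n)) ⟩
    (u ℚ.* ι N) ℚ.* (u ℚ.* ι N) ≡⟨ solve 2 (λ u n → (u :* n) :* (u :* n) := (u :* u) :* (n :* n)) refl u (ι N) ⟩
    (u ℚ.* u) ℚ.* (ι N ℚ.* ι N) ∎))
  where
  open ℚ.≤-Reasoning
  N = suc n
  t = isqrt (a ℕ.* (N ℕ.* N))
  u = ℤ.+ (suc t) ℚ./ N

-- Eigenvalues of regular graphs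

term≤∑ : {f : Fin n → ℚ} → (∀ i → 0ℚ ℚ.≤ f i) → ∀ i → f i ℚ.≤ ∑ℚ f
term≤∑ {n = n} {f = f} 0≤f i = begin
  f i                                  ≡⟨ ≡.sym (∑-𝟏 i f) ⟩
  ∑ℚ (λ j → 𝟏 (j Fin.≟ i) ℚ.* f j)     ≤⟨ ∑-mono-≤ bound ⟩
  ∑ℚ f                                 ∎
  where
  open ℚ.≤-Reasoning
  bound : ∀ j → 𝟏 (j Fin.≟ i) ℚ.* f j ℚ.≤ f j
  bound j with j Fin.≟ i
  ... | yes _ = ℚ.≤-reflexive (ℚ.*-identityˡ (f j))
  ... | no  _ = ℚ.≤-trans (ℚ.≤-reflexive (ℚ.*-zeroˡ (f j))) (0≤f j)

ι-nonNeg : ∀ a → 0ℚ ℚ.≤ ι a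
ι-nonNeg a = ℚ.nonNegative⁻¹ (ι a) {{ℚ.normalize-nonNeg a 1}}

ι-mono-≤ : ∀ {a b} → a ℕ.≤ b → ι a ℚ.≤ ι b
ι-mono-≤ {a} a≤b with ℕ.m≤n⇒m<n∨m≡n a≤b
... | inj₁ a<b  = ℚ.<⇒≤ (ι-mono-< a<b)
... | inj₂ refl = ℚ.≤-refl

infixl 7 _·_

_·_ : Graph n → (Fin n → ℚ) → Fin n → ℚ
(A · w) i = ∑ℚ (λ j → ι (A i j) ℚ.* w j)

sumSquares : (Fin n → ℚ) → ℚ
sumSquares w = ∑ℚ (λ i → w i ℚ.* w i)

-- By symmetry the columns also sum to k. Summing the eigenvector equation over all coordinates then
-- yields (k - l) ∑ v = 0.
∑-· : (A : Graph n) → Undirected A → ∀ k → Regular k A → ∀ w → ∑ℚ (A · w) ≡ ι k ℚ.* ∑ℚ w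
∑-· A undirected k regular w = begin
  ∑ℚ (λ i → ∑ℚ (λ j → ι (A i j) ℚ.* w j)) ≡⟨ ∑-comm (λ i j → ι (A i j) ℚ.* w j) ⟩
  ∑ℚ (λ j → ∑ℚ (λ i → ι (A i j) ℚ.* w j)) ≡⟨ sum-cong-≗ column ⟩
  ∑ℚ (λ j → ι k ℚ.* w j)                  ≡⟨ ≡.sym (*-distribˡ-sum (ι k) w) ⟩
  ι k ℚ.* ∑ℚ w                            ∎
  where
  open ≡.≡-Reasoning
  column : ∀ j → ∑ℚ (λ i → ι (A i j) ℚ.* w j) ≡ ι k ℚ.* w j
  column j = begin
    ∑ℚ (λ i → ι (A i j) ℚ.* w j) ≡⟨ ≡.sym (*-distribʳ-sum (w j) (λ i → ι (A i j))) ⟩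
    ∑ℚ (λ i → ι (A i j)) ℚ.* w j ≡⟨ ≡.cong (ℚ._* w j) (sum-cong-≗ λ i → ≡.cong ι (undirected i j)) ⟩
    ∑ℚ (λ i → ι (A j i)) ℚ.* w j ≡⟨ ≡.cong (ℚ._* w j) (≡.sym (ι-∑ (A j))) ⟩
    ι (∑ℕ (A j)) ℚ.* w j         ≡⟨ ≡.cong (λ d → ι d ℚ.* w j) (regular j) ⟩
    ι k ℚ.* w j                  ∎

-- The approximation of √a lies below √a, so it is first raised by 1 / (m + 1) to u with a < u².
-- Then l² < 4a gives |l| < 2u, and the doubled correction is less than ε.
eventually-square-bound : ∀ l a → (Eventually λ m → seq l m ℚ.* seq l m ℚ.< ι (4 ℕ.* a)) →
  ∣ l ∣ℝ ≤ℝ fromℕ 2 *ℝ √ a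
eventually-square-bound l a small ε ε>0 = eventually-map bound
  (eventually-× small (√Properties.1/suc<ε (ε ℚ.* ℚ.½) (half-pos ε>0)))
  where
  open ℚ.≤-Reasoning
  bound : ∀ m → seq l m ℚ.* seq l m ℚ.< ι (4 ℕ.* a) × ℤ.+ 1 ℚ./ suc m ℚ.< ε ℚ.* ℚ.½ →
    ℚ.∣ seq l m ∣ ℚ.< ι 2 ℚ.* √-seq a m ℚ.+ ε
  bound m (small , tiny) = begin-strict
    ℚ.∣ seq l m ∣
      <⟨ square-cancel-< 0≤2u square ⟩
    ι 2 ℚ.* u
      ≡⟨ solve 2 (λ r t → con (ι 2) :* (r :+ t) := con (ι 2) :* r :+ (t :+ t)) refl (√-seq a m) t ⟩
    ι 2 ℚ.* √-seq a m ℚ.+ (t ℚ.+ t)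
      <⟨ ℚ.+-monoʳ-< (ι 2 ℚ.* √-seq a m) (ℚ.+-mono-< tiny tiny) ⟩
    ι 2 ℚ.* √-seq a m ℚ.+ (ε ℚ.* ℚ.½ ℚ.+ ε ℚ.* ℚ.½)
      ≡⟨ ≡.cong (ι 2 ℚ.* √-seq a m ℚ.+_) (half+half ε) ⟩
    ι 2 ℚ.* √-seq a m ℚ.+ ε ∎
    where
    t = ℤ.+ 1 ℚ./ suc m
    u = √-seq a m ℚ.+ t
    0≤/ : ∀ b → 0ℚ ℚ.≤ ℤ.+ b ℚ./ suc m
    0≤/ b = ℚ.nonNegative⁻¹ (ℤ.+ b ℚ./ suc m) {{ℚ.normalize-nonNeg b (suc m)}}
    0≤2u : 0ℚ ℚ.≤ ι 2 ℚ.* u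
    0≤2u = ℚ.≤-trans (ℚ.≤-reflexive (≡.sym (ℚ.*-zeroʳ (ι 2))))
      (ℚ.*-monoˡ-≤-nonNeg (ι 2) (ℚ.+-mono-≤ (0≤/ (isqrt (a ℕ.* (suc m ℕ.* suc m)))) (0≤/ 1)))
    square : ℚ.∣ seq l m ∣ ℚ.* ℚ.∣ seq l m ∣ ℚ.< (ι 2 ℚ.* u) ℚ.* (ι 2 ℚ.* u)
    square = begin-strict
      ℚ.∣ seq l m ∣ ℚ.* ℚ.∣ seq l m ∣ ≡⟨ ∣p∣*∣p∣≡p*p (seq l m) ⟩
      seq l m ℚ.* seq l m             <⟨ small ⟩
      ι (4 ℕ.* a)                     ≡⟨ ι-* 4 a ⟩
      ι 4 ℚ.* ι a                     <⟨ ℚ.*-monoʳ-<-pos (ι 4) (ι<√-seq² a m) ⟩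
      ι 4 ℚ.* (u ℚ.* u)               ≡⟨ solve 1 (λ u → con (ι 4) :* (u :* u) := (con (ι 2) :* u) :* (con (ι 2) :* u)) refl u ⟩
      (ι 2 ℚ.* u) ℚ.* (ι 2 ℚ.* u)     ∎

-- `C` is a natural number and the inequality `C<16[k-1]` is strict, so 16 (k - 1) |w|² exceeds C
-- |w|² by at least |w|². This is the room for replacing l and v by rational approximations.
module _ (A : Graph n) (k : ℕ) (undirected : Undirected A) (regular : Regular k A)
  (C : ℕ) (C<16[k-1] : C ℕ.< 4 ℕ.* (4 ℕ.* (k ℕ.∸ 1)))
  (energy : ∀ w → sumSquares (λ i → ((A · w) i ℚ.+ (A · w) i) ℚ.- ∑ℚ w) ℚ.≤ ι C ℚ.* sumSquares w)
  (l : ℝ) (v : Vector ℝ n) (eigen : ∀ i → ∑ (λ j → fromℕ (A i j) *ℝ v j) ≈ℝ l *ℝ v i)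
  (∣l∣≉k : ¬ (∣ l ∣ℝ ≈ℝ fromℕ k))
  where

  private
    L : ℕ → ℚ
    L = seq l
    V : ℕ → Fin n → ℚ
    V m i = seq (v i) m
    S : ℕ → ℚ
    S m = ∑ℚ (V m)
    -- `d` is the defect of A v = l v at the m-th approximations and `e` that of 2A v - J v = 2 l v.
    -- The sum `η` collects (2 l v + e)² - (2 l v)² = e (4 l v + e), the amount by which the energy
    -- differs from 4 l² |v|².
    d : Fin n → ℕ → ℚ
    d i m = (A · V m) i ℚ.- L m ℚ.* V m i
    e : Fin n → ℕ → ℚ
    e i m = (d i m ℚ.+ d i m) ℚ.- S m
    η : ℕ → ℚ
    η m = ∑ℚ (λ i → e i m ℚ.* (ι 4 ℚ.* (L m ℚ.* V m i) ℚ.+ e i m))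

    d-null : ∀ i → Null (d i)
    d-null i = Null-cong
      (λ m → ≡.cong (ℚ._- L m ℚ.* V m i) (seq-∑ (λ j → fromℕ (A i j) *ℝ v j) m)) (eigen i)

    [k-L]*S-null : Null (λ m → (ι k ℚ.- L m) ℚ.* S m)
    [k-L]*S-null = Null-cong sum-d (Null-∑ {x = d} d-null)
      where
      open ≡.≡-Reasoning
      sum-d : ∀ m → ∑ℚ (λ i → d i m) ≡ (ι k ℚ.- L m) ℚ.* S m
      sum-d m = begin
        ∑ℚ (λ i → d i m)
          ≡⟨ ∑-distrib-sub (A · V m) (λ i → L m ℚ.* V m i) ⟩
        ∑ℚ (A · V m) ℚ.- ∑ℚ (λ i → L m ℚ.* V m i)
          ≡⟨ ≡.cong₂ ℚ._-_ (∑-· A undirected k regular (V m)) (≡.sym (*-distribˡ-sum (L m) (V m))) ⟩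
        ι k ℚ.* S m ℚ.- L m ℚ.* S m
          ≡⟨ solve 3 (λ k l s → k :* s :- l :* s := (k :- l) :* s) refl (ι k) (L m) (S m) ⟩
        (ι k ℚ.- L m) ℚ.* S m ∎

    -- Were the coordinate sum apart from 0, it could be cancelled from (k - l) ∑ v = 0, giving l =
    -- k against the hypothesis on |l|. Not being apart from 0, it is 0.
    S-null : Null S
    S-null = Null-cong (seq-∑ v) (¬Apart⇒Null (cauchy (∑ v)) λ apart →
      ∣l∣≉k (∣l∣≈k (Null-cancel apart
        (Null-cong (λ m → ≡.cong ((ι k ℚ.- L m) ℚ.*_) (≡.sym (seq-∑ v m))) [k-L]*S-null))))
      where
      ∣l∣≈k : Null (λ m → ι k ℚ.- L m) → ∣ l ∣ℝ ≈ℝ fromℕ k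
      ∣l∣≈k null ε ε>0 = eventually-map (λ m k~l → ∣p-q∣<ε {ℚ.∣ L m ∣} {ι k}
          (≡.subst (λ t → ℚ.∣ L m ∣ ℚ.- t ℚ.< ε) (ℚ.0≤p⇒∣p∣≡p (ι-nonNeg k))
            (ℚ.≤-<-trans (∣p∣-∣q∣≤∣p-q∣ (L m) (ι k))
              (≡.subst (ℚ._< ε) (≡.trans (≡.sym (ℚ.∣-p∣≡∣p∣ (ι k ℚ.- L m)))
                (≡.cong ℚ.∣_∣ (solve 2 (λ k l → :- (k :- l) := l :- k) refl (ι k) (L m)))) k~l)))
          (≡.subst (λ t → t ℚ.- ℚ.∣ L m ∣ ℚ.< ε) (ℚ.0≤p⇒∣p∣≡p (ι-nonNeg k))
            (ℚ.≤-<-trans (∣p∣-∣q∣≤∣p-q∣ (ι k) (L m)) k~l)))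
        (null ε ε>0)

    e-null : ∀ i → Null (e i)
    e-null i = Null-+ (Null-+ (d-null i) (d-null i)) (Null-neg S-null)

    η-null : Null η
    η-null = Null-∑ {x = λ i m → e i m ℚ.* (ι 4 ℚ.* (L m ℚ.* V m i) ℚ.+ e i m)} λ i → Null-cong
      (λ m → ≡.sym (ℚ.*-distribˡ-+ (e i m) (ι 4 ℚ.* (L m ℚ.* V m i)) (e i m)))
      -- The cofactor 4 l v is bounded because it is itself a real number.
      (Null-+ (Null-* (e-null i) (bounded (cauchy (fromℕ 4 *ℝ (l *ℝ v i)))))
              (Null-* (e-null i) (Null⇒Bounded (e-null i))))

    perturbed-energy : ∀ m → ι 4 ℚ.* (L m ℚ.* L m) ℚ.* sumSquares (V m) ℚ.+ η m ℚ.≤ ι C ℚ.* sumSquares (V m)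
    perturbed-energy m = ≡.subst (ℚ._≤ ι C ℚ.* sumSquares (V m)) (begin
      sumSquares (λ i → ((A · V m) i ℚ.+ (A · V m) i) ℚ.- S m)
        ≡⟨ sum-cong-≗ (λ i → expand (L m) (V m i) ((A · V m) i) (S m)) ⟩
      ∑ℚ (λ i → ι 4 ℚ.* (L m ℚ.* L m) ℚ.* (V m i ℚ.* V m i) ℚ.+ e i m ℚ.* (ι 4 ℚ.* (L m ℚ.* V m i) ℚ.+ e i m))
        ≡⟨ ∑-distrib-+ (λ i → ι 4 ℚ.* (L m ℚ.* L m) ℚ.* (V m i ℚ.* V m i)) _ ⟩
      ∑ℚ (λ i → ι 4 ℚ.* (L m ℚ.* L m) ℚ.* (V m i ℚ.* V m i)) ℚ.+ η m
        ≡⟨ ≡.cong (ℚ._+ η m) (≡.sym (*-distribˡ-sum (ι 4 ℚ.* (L m ℚ.* L m)) (λ i → V m i ℚ.* V m i))) ⟩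
      ι 4 ℚ.* (L m ℚ.* L m) ℚ.* sumSquares (V m) ℚ.+ η m ∎) (energy (V m))
      where
      open ≡.≡-Reasoning
      expand : ∀ l v a s → let d = a ℚ.- l ℚ.* v; e = (d ℚ.+ d) ℚ.- s in
        ((a ℚ.+ a) ℚ.- s) ℚ.* ((a ℚ.+ a) ℚ.- s)
          ≡ ι 4 ℚ.* (l ℚ.* l) ℚ.* (v ℚ.* v) ℚ.+ e ℚ.* (ι 4 ℚ.* (l ℚ.* v) ℚ.+ e)
      expand = solve 4 (λ l v a s → let d = a :- l :* v; e = (d :+ d) :- s in
        ((a :+ a) :- s) :* ((a :+ a) :- s)
          := con (ι 4) :* (l :* l) :* (v :* v) :+ e :* (con (ι 4) :* (l :* v) :+ e)) refl

    -- If l² ≥ 4 (k - 1) at stage m, the unit gap above `C` and the perturbed energy inequality give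
    -- |v|² ≤ |η|. But η is eventually below δ², while the coordinate i alone contributes more than
    -- δ² to |v|².
    square-bound : ∀ i → Apart (seq (v i)) → Eventually λ m → L m ℚ.* L m ℚ.< ι (4 ℕ.* (k ℕ.∸ 1))
    square-bound i (δ , δ>0 , v>δ) = eventually-map bound (eventually-× v>δ (η-null (δ ℚ.* δ) δδ>0))
      where
      open ℚ.≤-Reasoning
      δδ>0 : 0ℚ ℚ.< δ ℚ.* δ
      δδ>0 = ℚ.positive⁻¹ (δ ℚ.* δ) {{ℚ.pos*pos⇒pos δ {{ℚ.positive δ>0}} δ {{ℚ.positive δ>0}}}}
      bound : ∀ m → δ ℚ.< ℚ.∣ V m i ∣ × ℚ.∣ η m ∣ ℚ.< δ ℚ.* δ → L m ℚ.* L m ℚ.< ι (4 ℕ.* (k ℕ.∸ 1))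
      bound m (δ<v , η<δδ) = ℚ.≰⇒> λ T≤LL → ℚ.<-irrefl refl (begin-strict
        W
          ≡⟨ solve 2 (λ c w → w := ((con 1ℚ :+ c) :* w) :- c :* w) refl (ι C) W ⟩
        ((1ℚ ℚ.+ ι C) ℚ.* W) ℚ.- ι C ℚ.* W
          ≡⟨ ≡.cong (λ t → t ℚ.* W ℚ.- ι C ℚ.* W) (≡.sym (ι-+ 1 C)) ⟩
        ι (suc C) ℚ.* W ℚ.- ι C ℚ.* W
          ≤⟨ ℚ.+-monoˡ-≤ (ℚ.- (ι C ℚ.* W)) (ℚ.*-monoʳ-≤-nonNeg W {{ℚ.nonNegative 0≤W}} (ι-mono-≤ C<16[k-1])) ⟩
        ι (4 ℕ.* T) ℚ.* W ℚ.- ι C ℚ.* W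
          ≡⟨ ≡.cong (λ t → t ℚ.* W ℚ.- ι C ℚ.* W) (ι-* 4 T) ⟩
        ι 4 ℚ.* ι T ℚ.* W ℚ.- ι C ℚ.* W
          ≤⟨ ℚ.+-monoˡ-≤ (ℚ.- (ι C ℚ.* W)) (ℚ.*-monoʳ-≤-nonNeg W {{ℚ.nonNegative 0≤W}} (ℚ.*-monoˡ-≤-nonNeg (ι 4) T≤LL)) ⟩
        ι 4 ℚ.* (L m ℚ.* L m) ℚ.* W ℚ.- ι C ℚ.* W
          ≡⟨ solve 3 (λ x y z → x :- z := (x :+ y) :- y :- z) refl (ι 4 ℚ.* (L m ℚ.* L m) ℚ.* W) (η m) (ι C ℚ.* W) ⟩
        (ι 4 ℚ.* (L m ℚ.* L m) ℚ.* W ℚ.+ η m) ℚ.- η m ℚ.- ι C ℚ.* W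
          ≤⟨ ℚ.+-monoˡ-≤ (ℚ.- (ι C ℚ.* W)) (ℚ.+-monoˡ-≤ (ℚ.- η m) (perturbed-energy m)) ⟩
        ι C ℚ.* W ℚ.- η m ℚ.- ι C ℚ.* W
          ≡⟨ solve 2 (λ x y → x :- y :- x := :- y) refl (ι C ℚ.* W) (η m) ⟩
        ℚ.- η m
          ≤⟨ p≤∣p∣ (ℚ.- η m) ⟩
        ℚ.∣ ℚ.- η m ∣
          ≡⟨ ℚ.∣-p∣≡∣p∣ (η m) ⟩
        ℚ.∣ η m ∣
          <⟨ η<δδ ⟩
        δ ℚ.* δ
          ≤⟨ *-mono-≤-nonNeg (ℚ.0≤∣p∣ (V m i)) (ℚ.<⇒≤ δ>0) (ℚ.<⇒≤ δ<v) (ℚ.<⇒≤ δ<v) ⟩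
        ℚ.∣ V m i ∣ ℚ.* ℚ.∣ V m i ∣
          ≡⟨ ∣p∣*∣p∣≡p*p (V m i) ⟩
        V m i ℚ.* V m i
          ≤⟨ term≤∑ (λ j → square-nonNeg (V m j)) i ⟩
        W ∎)
        where
        T = 4 ℕ.* (k ℕ.∸ 1)
        W = sumSquares (V m)
        0≤W : 0ℚ ℚ.≤ W
        0≤W = ℚ.≤-trans (square-nonNeg (V m i)) (term≤∑ (λ j → square-nonNeg (V m j)) i)

  -- If the bound fails, no coordinate can be apart from 0, so every coordinate is 0, contrary to
  -- the hypothesis. Stability of `≤ℝ` turns this refutation into the bound.
  eigenvalue-bound : ¬ (∀ i → v i ≈ℝ fromℕ 0) → ∣ l ∣ℝ ≤ℝ fromℕ 2 *ℝ √ (k ℕ.∸ 1)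
  eigenvalue-bound v≉0 = ≤ℝ-stable ∣ l ∣ℝ (fromℕ 2 *ℝ √ (k ℕ.∸ 1)) λ ¬bound → v≉0 λ i →
    Null-cong (λ m → ≡.sym (ℚ.+-identityʳ (V m i))) (¬Apart⇒Null (cauchy (v i)) λ apart →
      ¬bound (eventually-square-bound l (k ℕ.∸ 1) (square-bound i apart)))

-- Finite fields

prime∤! : ∀ {p} → Prime p → ∀ n → n ℕ.< p → ¬ (p ℕ.∣ n ℕ.!)
prime∤! {p} pp zero    n<p p∣1 = ℕ.<⇒≢ (ℕ.nonTrivial⇒n>1 p {{prime⇒nonTrivial pp}}) (≡.sym (ℕ.∣1⇒≡1 p∣1))
prime∤! {p} pp (suc n) n<p p∣n! with euclidsLemma (suc n) (n ℕ.!) pp p∣n!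
... | inj₁ p∣1+n = ℕ.<⇒≱ n<p (ℕ.∣⇒≤ p∣1+n)
... | inj₂ p∣n!′ = prime∤! pp n (ℕ.<-trans (ℕ.n<1+n n) n<p) p∣n!′

-- The prime p divides p! = C(p,k) k! (p-k)! but neither of the two factorials of smaller numbers.
prime∣C : ∀ {p k} → Prime p → 0 ℕ.< k → k ℕ.< p → p ℕ.∣ p ℕ.C k
prime∣C {p} {k} pp 0<k k<p with euclidsLemma (p ℕ.C k) (k ℕ.! ℕ.* (p ℕ.∸ k) ℕ.!) pp p∣product
  where
  instance
    p≢0 = prime⇒nonZero pp
    k!≢0 = k ℕ.!* (p ℕ.∸ k) !≢0
  C*k![p-k]! : (p ℕ.C k) ℕ.* (k ℕ.! ℕ.* (p ℕ.∸ k) ℕ.!) ≡ p ℕ.!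
  C*k![p-k]! = ≡.trans (≡.cong (ℕ._* (k ℕ.! ℕ.* (p ℕ.∸ k) ℕ.!)) (ℕ.nCk≡n!/k![n-k]! (ℕ.<⇒≤ k<p)))
    (ℕ.m/n*n≡m (ℕ.k![n∸k]!∣n! (ℕ.<⇒≤ k<p)))
  p∣product : p ℕ.∣ (p ℕ.C k) ℕ.* (k ℕ.! ℕ.* (p ℕ.∸ k) ℕ.!)
  p∣product = ≡.subst (p ℕ.∣_) (≡.sym C*k![p-k]!)
    (≡.subst (λ n → p ℕ.∣ n ℕ.!) (ℕ.suc-pred p) (ℕ.divides (ℕ.pred p ℕ.!)
      (≡.trans (≡.cong (ℕ._* ℕ.pred p ℕ.!) (ℕ.suc-pred p)) (ℕ.*-comm p (ℕ.pred p ℕ.!)))))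
... | inj₁ p∣C = p∣C
... | inj₂ p∣k![p-k]! with euclidsLemma (k ℕ.!) ((p ℕ.∸ k) ℕ.!) pp p∣k![p-k]!
...   | inj₁ p∣k!     = contradiction p∣k! (prime∤! pp k k<p)
...   | inj₂ p∣[p-k]! = contradiction p∣[p-k]! (prime∤! pp (p ℕ.∸ k) (ℕ.∸-monoʳ-< 0<k (ℕ.<⇒≤ k<p)))

module FiniteFieldProperties {q c ℓ₁ ℓ₂} (F : FiniteField q c ℓ₁ ℓ₂) where
  open FiniteField F hiding (zero)
    renaming (refl to ≈-refl; sym to ≈-sym; trans to ≈-trans)
  open CommutativeRing commutativeRing using
    (ring; semiring; commutativeSemiring; +-commutativeMonoid; *-commutativeMonoid)
  open RingProperties ring using
    ( -‿involutive; -‿distribˡ-*; -‿distribʳ-*; +-inverseˡ-unique; +-inverseʳ-unique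
    ; +-cancelˡ; -0#≈0#; x+x≈x⇒x≈0; x∙y⁻¹≈ε⇒x≈y; -1*x≈-x; -‿+-comm)
  open SemiringMult semiring using (×1-homo-*; ×-assoc-*; ×-assocˡ; ×-homo-1; ×-congʳ) renaming (_×_ to _·#_)
  open CommutativeSemiringExp commutativeSemiring using (^-congˡ; ^-assocʳ; ^-distrib-*)
  open CommutativeSemigroupProperties
    (CommutativeMonoid.commutativeSemigroup *-commutativeMonoid)
    using (interchange; x∙yz≈y∙xz)

  Bijection : Set _
  Bijection = Inverse setoid setoid

  bijection : (f g : Carrier → Carrier) → (∀ {x y} → x ≈ y → f x ≈ f y) → (∀ {x y} → x ≈ y → g x ≈ g y) →
    (∀ x → f (g x) ≈ x) → (∀ x → g (f x) ≈ x) → Bijection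
  bijection f g f-cong g-cong fg gf = record
    { to = f ; from = g ; to-cong = f-cong ; from-cong = g-cong
    ; inverse = (λ {y} x≈gy → ≈-trans (f-cong x≈gy) (fg y)) , (λ {y} x≈fy → ≈-trans (g-cong x≈fy) (gf y)) }

  module SumOver {a b} (M : CommutativeMonoid a b) where
    private module M = CommutativeMonoid M
    open CommutativeMonoidSum M public using (sum; sum-cong-≋)
    open CommutativeMonoidSum M using (sum-permute)

    -- Conjugation by the enumeration turns `φ` into a permutation of `Fin q`. The summand has to
    -- respect `≈` because the enumeration meets only one representative of each class.
    sum-reindex : (φ : Bijection) (g : Carrier → M.Carrier) → (∀ {x y} → x ≈ y → g x M.≈ g y) →
      sum (g ∘ element) M.≈ sum (g ∘ Inverse.to φ ∘ element)
    sum-reindex φ g g-cong = M.trans (sum-permute (g ∘ element) π)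
      (sum-cong-≋ λ i → g-cong (element∘index (to (element i))))
      where
      open Inverse φ
      π : Perm.Permutation q q
      π = Perm.permutation (index ∘ to ∘ element) (index ∘ from ∘ element)
        (λ i → ≡.trans (index-cong (≈-trans (to-cong (element∘index (from (element i)))) (strictlyInverseˡ (element i))))
                       (index∘element i))
        (λ i → ≡.trans (index-cong (≈-trans (from-cong (element∘index (to (element i)))) (strictlyInverseʳ (element i))))
                       (index∘element i))

  -- Inverses, squares and bijections of the field

  module _ where
    open SetoidReasoning setoid

    element-injective : ∀ {i j} → element i ≈ element j → i ≡ j
    element-injective {i} {j} eq =
      ≡.trans (≡.sym (index∘element i)) (≡.trans (index-cong eq) (index∘element j))

    1≉0 : ¬ (1# ≈ 0#)
    1≉0 1≈0 = #-irrefl ≈-refl (invertible⇒# {0#} {0#} (0# , trivial _ , trivial _))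
      where
      trivial : ∀ x → x ≈ 1#
      trivial x = begin
        x       ≈⟨ *-identityʳ x ⟨
        x * 1#  ≈⟨ *-congˡ 1≈0 ⟩
        x * 0#  ≈⟨ zeroʳ x ⟩
        0#      ≈⟨ 1≈0 ⟨
        1#      ∎

    -- A finite search decides whether an inverse exists. If none does, x is not apart from 0, and
    -- tightness of the apartness gives x = 0.
    inverse : ∀ {x} → ¬ (x ≈ 0#) → ∃ λ y → x * y ≈ 1#
    inverse {x} x≉0 with Fin.any? (λ i → x * element i ≈? 1#)
    ... | yes (i , eq) = element i , eq
    ... | no  ¬inv     = contradiction (proj₁ (tight x 0#) ¬x#0) x≉0
      where
      ¬x#0 : ¬ (x # 0#)
      ¬x#0 x#0 with #⇒invertible x#0
      ... | y , _ , eq = ¬inv (index y , (begin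
        x * element (index y) ≈⟨ *-congˡ (element∘index y) ⟩
        x * y                 ≈⟨ *-congʳ (+-identityʳ x) ⟨
        (x + 0#) * y          ≈⟨ *-congʳ (+-congˡ -0#≈0#) ⟨
        (x + - 0#) * y        ≈⟨ eq ⟩
        1#                    ∎))

    *-cancelˡ-≉0 : ∀ {x y z} → ¬ (x ≈ 0#) → x * y ≈ x * z → y ≈ z
    *-cancelˡ-≉0 {x} {y} {z} x≉0 eq with inverse x≉0
    ... | x⁻¹ , xx⁻¹≈1 = begin
      y             ≈⟨ undo y ⟨
      x⁻¹ * (x * y) ≈⟨ *-congˡ eq ⟩
      x⁻¹ * (x * z) ≈⟨ undo z ⟩
      z             ∎
      where
      undo : ∀ w → x⁻¹ * (x * w) ≈ w
      undo w = begin
        x⁻¹ * (x * w) ≈⟨ x∙yz≈y∙xz x⁻¹ x w ⟩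
        x * (x⁻¹ * w) ≈⟨ *-assoc x x⁻¹ w ⟨
        x * x⁻¹ * w   ≈⟨ *-congʳ xx⁻¹≈1 ⟩
        1# * w        ≈⟨ *-identityˡ w ⟩
        w             ∎

    *-≉0 : ∀ {x y} → ¬ (x ≈ 0#) → ¬ (y ≈ 0#) → ¬ (x * y ≈ 0#)
    *-≉0 {x} x≉0 y≉0 xy≈0 = y≉0 (*-cancelˡ-≉0 x≉0 (≈-trans xy≈0 (≈-sym (zeroʳ x))))

    square-resp-≈ : ∀ {s t} → s ≈ t → NonzeroSquare s → NonzeroSquare t
    square-resp-≈ s≈t (x , x≉0 , eq) = x , x≉0 , ≈-trans (≈-sym s≈t) eq

    square-≉0 : ∀ {s} → NonzeroSquare s → ¬ (s ≈ 0#)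
    square-≉0 (x , x≉0 , eq) s≈0 = *-≉0 x≉0 x≉0 (≈-trans (≈-sym eq) s≈0)

    square-1 : NonzeroSquare 1#
    square-1 = 1# , 1≉0 , ≈-sym (*-identityʳ 1#)

    square-* : ∀ {s t} → NonzeroSquare s → NonzeroSquare t → NonzeroSquare (s * t)
    square-* (x , x≉0 , s≈xx) (y , y≉0 , t≈yy) =
      x * y , *-≉0 x≉0 y≉0 , ≈-trans (*-cong s≈xx t≈yy) (interchange x x y y)

    square-cancelˡ : ∀ {s t} → NonzeroSquare s → NonzeroSquare (s * t) → NonzeroSquare t
    square-cancelˡ {s} {t} (x , x≉0 , s≈xx) (z , z≉0 , st≈zz) with inverse x≉0
    ... | x⁻¹ , xx⁻¹≈1 = z * x⁻¹ , *-≉0 z≉0 x⁻¹≉0 , *-cancelˡ-≉0 (*-≉0 x≉0 x≉0) (begin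
      x * x * t                         ≈⟨ *-congʳ s≈xx ⟨
      s * t                             ≈⟨ st≈zz ⟩
      z * z                             ≈⟨ *-identityʳ (z * z) ⟨
      z * z * 1#                        ≈⟨ *-congˡ (*-identityʳ 1#) ⟨
      z * z * (1# * 1#)                 ≈⟨ *-congˡ (*-cong xx⁻¹≈1 xx⁻¹≈1) ⟨
      z * z * (x * x⁻¹ * (x * x⁻¹))     ≈⟨ *-congˡ (interchange x x⁻¹ x x⁻¹) ⟩
      z * z * (x * x * (x⁻¹ * x⁻¹))     ≈⟨ x∙yz≈y∙xz (z * z) (x * x) (x⁻¹ * x⁻¹) ⟩
      x * x * (z * z * (x⁻¹ * x⁻¹))     ≈⟨ *-congˡ (interchange z z x⁻¹ x⁻¹) ⟩
      x * x * (z * x⁻¹ * (z * x⁻¹))     ∎)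
      where
      x⁻¹≉0 : ¬ (x⁻¹ ≈ 0#)
      x⁻¹≉0 x⁻¹≈0 = 1≉0 (≈-trans (≈-sym xx⁻¹≈1) (≈-trans (*-congˡ x⁻¹≈0) (zeroʳ x)))

    -x*-x≈x*x : ∀ x → - x * - x ≈ x * x
    -x*-x≈x*x x = begin
      - x * - x     ≈⟨ -‿distribˡ-* x (- x) ⟨
      - (x * - x)   ≈⟨ -‿cong (-‿distribʳ-* x x) ⟨
      - - (x * x)   ≈⟨ -‿involutive (x * x) ⟩
      x * x         ∎

    square-roots : ∀ {x z} → x * x ≈ z * z → x ≈ z ⊎ x ≈ - z
    square-roots {x} {z} xx≈zz with x + z ≈? 0#
    ... | yes x+z≈0 = inj₂ (+-inverseˡ-unique x z x+z≈0)
    ... | no  x+z≉0 = inj₁ (*-cancelˡ-≉0 x+z≉0 (begin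
      (x + z) * x   ≈⟨ distribʳ x x z ⟩
      x * x + z * x ≈⟨ +-cong xx≈zz (*-comm z x) ⟩
      z * z + x * z ≈⟨ +-comm (z * z) (x * z) ⟩
      x * z + z * z ≈⟨ distribʳ z x z ⟨
      (x + z) * z   ∎))

    translation : Carrier → Bijection
    translation a = bijection (a +_) (- a +_) +-congˡ +-congˡ
      (λ x → cancel (-‿inverseʳ a) x) (λ x → cancel (-‿inverseˡ a) x)
      where
      cancel : ∀ {a b} → a + b ≈ 0# → ∀ x → a + (b + x) ≈ x
      cancel {a} {b} eq x = ≈-trans (≈-sym (+-assoc a b x)) (≈-trans (+-congʳ eq) (+-identityˡ x))

    scaling : ∀ {a} → ¬ (a ≈ 0#) → Bijection
    scaling {a} a≉0 with inverse a≉0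
    ... | a⁻¹ , aa⁻¹≈1 = bijection (a *_) (a⁻¹ *_) *-congˡ *-congˡ
      (cancel aa⁻¹≈1) (cancel (≈-trans (*-comm a⁻¹ a) aa⁻¹≈1))
      where
      cancel : ∀ {a b} → a * b ≈ 1# → ∀ x → a * (b * x) ≈ x
      cancel {a} {b} eq x = ≈-trans (≈-sym (*-assoc a b x)) (≈-trans (*-congʳ eq) (*-identityˡ x))

    -- The `with` in `scaling` keeps its forward map from reducing to multiplication; this equation
    -- unblocks it.
    scaling-to : ∀ {a} (a≉0 : ¬ (a ≈ 0#)) x → Inverse.to (scaling a≉0) x ≡ a * x
    scaling-to a≉0 x with inverse a≉0
    ... | _ = refl

    infix 9 _⁻¹
    -- The convention that 0 is its own inverse makes inversion a total involution, hence a
    -- bijection along which sums over the whole field can be reindexed.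
    _⁻¹ : Carrier → Carrier
    x ⁻¹ with x ≈? 0#
    ... | yes _   = 0#
    ... | no  x≉0 = proj₁ (inverse x≉0)

    ⁻¹-zero : ∀ {x} → x ≈ 0# → x ⁻¹ ≡ 0#
    ⁻¹-zero {x} x≈0 with x ≈? 0#
    ... | yes _   = refl
    ... | no  x≉0 = contradiction x≈0 x≉0

    *-⁻¹ : ∀ {x} → ¬ (x ≈ 0#) → x * x ⁻¹ ≈ 1#
    *-⁻¹ {x} x≉0 with x ≈? 0#
    ... | yes x≈0 = contradiction x≈0 x≉0
    ... | no  x≉0 = proj₂ (inverse x≉0)

    ⁻¹-≉0 : ∀ {x} → ¬ (x ≈ 0#) → ¬ (x ⁻¹ ≈ 0#)
    ⁻¹-≉0 {x} x≉0 x⁻¹≈0 = 1≉0 (≈-trans (≈-sym (*-⁻¹ x≉0)) (≈-trans (*-congˡ x⁻¹≈0) (zeroʳ x)))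

    ⁻¹-cong : ∀ {x y} → x ≈ y → x ⁻¹ ≈ y ⁻¹
    ⁻¹-cong {x} {y} x≈y with x ≈? 0#
    ... | yes x≈0 = reflexive (≡.sym (⁻¹-zero (≈-trans (≈-sym x≈y) x≈0)))
    ... | no  x≉0 = *-cancelˡ-≉0 x≉0 (begin
      x * proj₁ (inverse x≉0) ≈⟨ proj₂ (inverse x≉0) ⟩
      1#                      ≈⟨ *-⁻¹ (λ y≈0 → x≉0 (≈-trans x≈y y≈0)) ⟨
      y * y ⁻¹                ≈⟨ *-congʳ x≈y ⟨
      x * y ⁻¹                ∎)

    ⁻¹-involutive : ∀ x → (x ⁻¹) ⁻¹ ≈ x
    ⁻¹-involutive x = helper (x ≈? 0#)
      where
      helper : Dec (x ≈ 0#) → (x ⁻¹) ⁻¹ ≈ x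
      helper (yes x≈0) = ≈-trans (reflexive (⁻¹-zero (reflexive (⁻¹-zero x≈0)))) (≈-sym x≈0)
      helper (no  x≉0) = *-cancelˡ-≉0 (⁻¹-≉0 x≉0) (begin
        x ⁻¹ * (x ⁻¹) ⁻¹ ≈⟨ *-⁻¹ (⁻¹-≉0 x≉0) ⟩
        1#               ≈⟨ *-⁻¹ x≉0 ⟨
        x * x ⁻¹         ≈⟨ *-comm x (x ⁻¹) ⟩
        x ⁻¹ * x         ∎)

    inversion : Bijection
    inversion = bijection _⁻¹ _⁻¹ ⁻¹-cong ⁻¹-cong ⁻¹-involutive ⁻¹-involutive

    -- Translating by 1 does not change the sum of all field elements.
    q·1≈0 : q ·# 1# ≈ 0#
    q·1≈0 = +-cancelˡ (sum element) (q ·# 1#) 0# (begin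
      sum element + q ·# 1#                      ≈⟨ +-congˡ (sum-replicate q) ⟨
      sum element + sum {q} (λ _ → 1#)           ≈⟨ ∑-distrib-+′ element (λ _ → 1#) ⟨
      sum (λ i → element i + 1#)                 ≈⟨ sum-cong-≋ (λ i → +-comm (element i) 1#) ⟩
      sum (λ i → 1# + element i)                 ≈⟨ sum-reindex (translation 1#) id id ⟨
      sum element                                ≈⟨ +-identityʳ (sum element) ⟨
      sum element + 0#                           ∎)
      where
      open SumOver +-commutativeMonoid
      open CommutativeMonoidSum +-commutativeMonoid using (sum-replicate) renaming (∑-distrib-+ to ∑-distrib-+′)

    -- If 2 = 0 then 4 = 0, so q ≡ 1 mod 4 gives q · 1 = 1, whereas q · 1 = 0.
    2≉0 : q ℕ.% 4 ≡ 1 → ¬ (1# + 1# ≈ 0#)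
    2≉0 q%4≡1 2≈0 = 1≉0 (begin
      1#                                    ≈⟨ +-identityʳ 1# ⟨
      1# + 0#                               ≈⟨ +-congˡ (zeroʳ ((q ℕ./ 4) ·# 1#)) ⟨
      1# + (q ℕ./ 4) ·# 1# * 0#             ≈⟨ +-congˡ (*-congˡ 4≈0) ⟨
      1# + (q ℕ./ 4) ·# 1# * (4 ·# 1#)      ≈⟨ +-congˡ (×1-homo-* (q ℕ./ 4) 4) ⟨
      (1 ℕ.+ (q ℕ./ 4) ℕ.* 4) ·# 1#         ≡⟨ ≡.cong (λ r → (r ℕ.+ (q ℕ./ 4) ℕ.* 4) ·# 1#) q%4≡1 ⟨
      (q ℕ.% 4 ℕ.+ (q ℕ./ 4) ℕ.* 4) ·# 1#   ≡⟨ ≡.cong (_·# 1#) (ℕ.m≡m%n+[m/n]*n q 4) ⟨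
      q ·# 1#                               ≈⟨ q·1≈0 ⟩
      0#                                    ∎)
      where
      4≈0 : 4 ·# 1# ≈ 0#
      4≈0 = begin
        4 ·# 1#                 ≈⟨ ×1-homo-* 2 2 ⟩
        2 ·# 1# * (2 ·# 1#)     ≈⟨ *-congʳ (≈-trans (+-congˡ (+-identityʳ 1#)) 2≈0) ⟩
        0# * (2 ·# 1#)          ≈⟨ zeroˡ _ ⟩
        0#                      ∎

    x≉-x : q ℕ.% 4 ≡ 1 → ∀ {x} → ¬ (x ≈ 0#) → ¬ (x ≈ - x)
    x≉-x q%4≡1 {x} x≉0 x≈-x = *-≉0 x≉0 (2≉0 q%4≡1) (begin
      x * (1# + 1#)    ≈⟨ distribˡ x 1# 1# ⟩
      x * 1# + x * 1#  ≈⟨ +-cong (*-identityʳ x) (*-identityʳ x) ⟩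
      x + x            ≈⟨ +-congˡ x≈-x ⟩
      x + - x          ≈⟨ -‿inverseʳ x ⟩
      0#               ∎)

    +-factor : ∀ a {t t⁻¹} → t * t⁻¹ ≈ 1# → a + t ≈ t * (1# + a * t⁻¹)
    +-factor a {t} {t⁻¹} tt⁻¹≈1 = begin
      a + t                     ≈⟨ +-comm a t ⟩
      t + a                     ≈⟨ +-cong (*-identityʳ t) (≈-trans (*-congˡ tt⁻¹≈1) (*-identityʳ a)) ⟨
      t * 1# + a * (t * t⁻¹)    ≈⟨ +-congˡ (x∙yz≈y∙xz a t t⁻¹) ⟩
      t * 1# + t * (a * t⁻¹)    ≈⟨ distribˡ t 1# (a * t⁻¹) ⟨
      t * (1# + a * t⁻¹)        ∎

    +-telescope : ∀ a b t → b + t ≈ (b - a) + (a + t)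
    +-telescope a b t = begin
      b + t                   ≈⟨ +-congʳ (+-identityʳ b) ⟨
      (b + 0#) + t            ≈⟨ +-congʳ (+-congˡ (-‿inverseˡ a)) ⟨
      (b + (- a + a)) + t     ≈⟨ +-congʳ (+-assoc b (- a) a) ⟨
      ((b - a) + a) + t       ≈⟨ +-assoc (b - a) a t ⟩
      (b - a) + (a + t)       ∎

    -- Powers and the Frobenius map

    ^-≉0 : ∀ {x} → ¬ (x ≈ 0#) → ∀ n → ¬ (x ^ n ≈ 0#)
    ^-≉0 x≉0 zero    = 1≉0
    ^-≉0 x≉0 (suc n) = *-≉0 x≉0 (^-≉0 x≉0 n)

    -- The element of `Fin n` witnesses that the exponent is positive; 0 to the power 0 is 1.
    0^n≈0 : ∀ {x n} → x ≈ 0# → Fin n → x ^ n ≈ 0#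
    0^n≈0 {x} {suc n} x≈0 _ = ≈-trans (*-congʳ x≈0) (zeroˡ (x ^ n))

    -- Both h and u take the value x on one of the two sets {0}, F ∖ {0} and 1 on the other,
    -- and scaling by x permutes the factors of ∏ g, the product of all nonzero elements.
    x^q≈x : ∀ x → x ^ q ≈ x
    x^q≈x x with x ≈? 0#
    ... | yes x≈0 = ≈-trans (0^n≈0 x≈0 (index x)) (≈-sym x≈0)
    ... | no  x≉0 = begin
      x ^ q                                          ≈⟨ sum-replicate q ⟨
      ∏ {q} (λ _ → x)                                ≈⟨ sum-cong-≋ (λ i → h*u (element i)) ⟨
      ∏ (λ i → h (element i) * u (element i))        ≈⟨ ∏-distrib-* (h ∘ element) (u ∘ element) ⟩
      ∏ (h ∘ element) * ∏ (u ∘ element)              ≈⟨ *-cong ∏h≈1 ∏u≈x ⟩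
      1# * x                                         ≈⟨ *-identityˡ x ⟩
      x                                              ∎
      where
      open SumOver *-commutativeMonoid using (sum-cong-≋; sum-reindex) renaming (sum to ∏)
      open CommutativeMonoidSum *-commutativeMonoid using (sum-replicate)
        renaming (∑-distrib-+ to ∏-distrib-*)
      select : ∀ {y} → Dec (y ≈ 0#) → Carrier → Carrier → Carrier
      select (yes _) a b = a
      select (no  _) a b = b
      g h u : Carrier → Carrier
      g y = select (y ≈? 0#) 1# y
      h y = select (y ≈? 0#) 1# x
      u y = select (y ≈? 0#) x 1#
      h*u : ∀ y → h y * u y ≈ x
      h*u y with y ≈? 0#
      ... | yes _ = *-identityˡ x
      ... | no  _ = *-identityʳ x
      g-cong : ∀ {y z} → y ≈ z → g y ≈ g z
      g-cong {y} {z} y≈z with y ≈? 0# | z ≈? 0#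
      ... | yes _   | yes _   = ≈-refl
      ... | yes y≈0 | no  z≉0 = contradiction (≈-trans (≈-sym y≈z) y≈0) z≉0
      ... | no  y≉0 | yes z≈0 = contradiction (≈-trans y≈z z≈0) y≉0
      ... | no  _   | no  _   = y≈z
      g-* : ∀ y → g (x * y) ≈ h y * g y
      g-* y with x * y ≈? 0# | y ≈? 0#
      ... | yes _    | yes _   = ≈-sym (*-identityˡ 1#)
      ... | yes xy≈0 | no  y≉0 = contradiction xy≈0 (*-≉0 x≉0 y≉0)
      ... | no  xy≉0 | yes y≈0 = contradiction (≈-trans (*-congˡ y≈0) (zeroʳ x)) xy≉0
      ... | no  _    | no  _   = ≈-refl
      g≉0 : ∀ y → ¬ (g y ≈ 0#)
      g≉0 y with y ≈? 0#
      ... | yes _   = 1≉0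
      ... | no  y≉0 = y≉0
      ∏≉0 : ∀ {n} (t : Fin n → Carrier) → (∀ i → ¬ (t i ≈ 0#)) → ¬ (∏ t ≈ 0#)
      ∏≉0 {zero}  t t≉0 = 1≉0
      ∏≉0 {suc n} t t≉0 = *-≉0 (t≉0 zero) (∏≉0 (t ∘ suc) (t≉0 ∘ suc))
      ∏h≈1 : ∏ (h ∘ element) ≈ 1#
      ∏h≈1 = *-cancelˡ-≉0 (∏≉0 (g ∘ element) (g≉0 ∘ element)) (begin
        ∏ (g ∘ element) * ∏ (h ∘ element)                  ≈⟨ *-comm _ _ ⟩
        ∏ (h ∘ element) * ∏ (g ∘ element)                  ≈⟨ ∏-distrib-* (h ∘ element) (g ∘ element) ⟨
        ∏ (λ i → h (element i) * g (element i))            ≈⟨ sum-cong-≋ (λ i → g-* (element i)) ⟨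
        ∏ (λ i → g (x * element i))
          ≈⟨ sum-cong-≋ (λ i → reflexive (≡.cong g (scaling-to x≉0 (element i)))) ⟨
        ∏ (λ i → g (Inverse.to (scaling x≉0) (element i))) ≈⟨ sum-reindex (scaling x≉0) g g-cong ⟨
        ∏ (g ∘ element)                                    ≈⟨ *-identityʳ _ ⟨
        ∏ (g ∘ element) * 1#                               ∎)
      ∏u≈x : ∏ (u ∘ element) ≈ x
      ∏u≈x = ≈-trans (sum-single *-commutativeMonoid (index 0#) (u ∘ element) others) at-0
        where
        others : ∀ j → ¬ (j ≡ index 0#) → u (element j) ≈ 1#
        others j j≢0 with element j ≈? 0#
        ... | yes eq = contradiction (≡.trans (≡.sym (index∘element j)) (index-cong eq)) j≢0
        ... | no  _  = ≈-refl
        at-0 : u (element (index 0#)) ≈ x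
        at-0 with element (index 0#) ≈? 0#
        ... | yes _  = ≈-refl
        ... | no ≉0  = contradiction (element∘index 0#) ≉0

    -- Here 0 = q · 1 = (p · 1)^e, and a nonzero element has no vanishing power.
    characteristic : ∀ {p e} → q ≡ p ℕ.^ e → p ·# 1# ≈ 0#
    characteristic {p} {e} q≡p^e with p ·# 1# ≈? 0#
    ... | yes p≈0 = p≈0
    ... | no  p≉0 = contradiction
      (≈-trans (≈-sym (p^n·1 e)) (≈-trans (reflexive (≡.cong (_·# 1#) (≡.sym q≡p^e))) q·1≈0)) (^-≉0 p≉0 e)
      where
      p^n·1 : ∀ n → (p ℕ.^ n) ·# 1# ≈ (p ·# 1#) ^ n
      p^n·1 zero    = ×-homo-1 1#
      p^n·1 (suc n) = ≈-trans (×1-homo-* p (p ℕ.^ n)) (*-congˡ (p^n·1 n))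

    multiple·x≈0 : ∀ {p n} → p ·# 1# ≈ 0# → p ℕ.∣ n → ∀ x → n ·# x ≈ 0#
    multiple·x≈0 {p} {n} p≈0 p∣n x = begin
      n ·# x                    ≡⟨ ≡.cong (_·# x) (ℕ._∣_.equality p∣n) ⟩
      (m ℕ.* p) ·# x            ≈⟨ ×-assocˡ x m p ⟨
      m ·# (p ·# x)             ≈⟨ ×-congʳ m (×-congʳ p (*-identityˡ x)) ⟨
      m ·# (p ·# (1# * x))      ≈⟨ ×-congʳ m (×-assoc-* p 1# x) ⟨
      m ·# (p ·# 1# * x)        ≈⟨ ×-congʳ m (≈-trans (*-congʳ p≈0) (zeroˡ x)) ⟩
      m ·# 0#                   ≈⟨ ×-congʳ m (zeroˡ 0#) ⟨
      m ·# (0# * 0#)            ≈⟨ ×-assoc-* m 0# 0# ⟨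
      m ·# 0# * 0#              ≈⟨ zeroʳ _ ⟩
      0#                        ∎
      where m = ℕ._∣_.quotient p∣n

    -- In the binomial expansion all coefficients between the first and the last are multiples of p,
    -- hence vanish in the field.
    ^p-+ : ∀ {p} → Prime p → p ·# 1# ≈ 0# → ∀ x y → (x + y) ^ p ≈ x ^ p + y ^ p
    ^p-+ {zero}  pp p≈0 x y = contradiction (prime⇒nonZero pp) λ ()
    ^p-+ {suc m} pp p≈0 x y = begin
      (x + y) ^ p                                     ≈⟨ theorem p x y ⟩
      term zero + sum (term ∘ suc)                    ≈⟨ +-cong first (sum-init-last (term ∘ suc)) ⟩
      y ^ p + (sum (λ i → term (suc (inject₁ i))) + term (suc (Fin.fromℕ m)))
        ≈⟨ +-congˡ (+-cong (≈-trans (sum-cong-≋ middle) (sum-replicate-zero m)) last-term) ⟩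
      y ^ p + (0# + x ^ p)                            ≈⟨ +-congˡ (+-identityˡ (x ^ p)) ⟩
      y ^ p + x ^ p                                   ≈⟨ +-comm (y ^ p) (x ^ p) ⟩
      x ^ p + y ^ p                                   ∎
      where
      open CommutativeSemiringBinomial commutativeSemiring using (theorem; binomialTerm)
      open CommutativeMonoidSum +-commutativeMonoid using (sum; sum-init-last; sum-cong-≋; sum-replicate-zero)
      p = suc m
      term : Fin (suc p) → Carrier
      term = binomialTerm x y p
      first : term zero ≈ y ^ p
      first = ≈-trans (×-homo-1 _) (*-identityˡ (y ^ p))
      middle : ∀ i → term (suc (inject₁ i)) ≈ 0#
      middle i = multiple·x≈0 p≈0
        (prime∣C pp ℕ.z<s (ℕ.s<s (≡.subst (ℕ._< m) (≡.sym (Fin.toℕ-inject₁ i)) (Fin.toℕ<n i)))) _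
      last-term : term (suc (Fin.fromℕ m)) ≈ x ^ p
      last-term = begin
        (p ℕ.C toℕ (Fin.fromℕ p)) ·# (x ^ toℕ (Fin.fromℕ p) * y ^ (p ℕ.∸ toℕ (Fin.fromℕ p)))
          ≡⟨ ≡.cong (λ k → (p ℕ.C k) ·# (x ^ k * y ^ (p ℕ.∸ k))) (Fin.toℕ-fromℕ p) ⟩
        (p ℕ.C p) ·# (x ^ p * y ^ (p ℕ.∸ p))
          ≡⟨ ≡.cong₂ (λ c d → c ·# (x ^ p * y ^ d)) (ℕ.nCn≡1 p) (ℕ.n∸n≡0 p) ⟩
        1 ·# (x ^ p * 1#)
          ≈⟨ ×-homo-1 _ ⟩
        x ^ p * 1#
          ≈⟨ *-identityʳ (x ^ p) ⟩
        x ^ p ∎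

    ^p^k-+ : ∀ {p} → Prime p → p ·# 1# ≈ 0# → ∀ k x y → (x + y) ^ (p ℕ.^ k) ≈ x ^ (p ℕ.^ k) + y ^ (p ℕ.^ k)
    ^p^k-+ pp p≈0 zero x y = ≈-trans (*-identityʳ (x + y)) (≈-sym (+-cong (*-identityʳ x) (*-identityʳ y)))
    ^p^k-+ {p} pp p≈0 (suc k) x y = begin
      (x + y) ^ (p ℕ.* p ℕ.^ k)                      ≈⟨ ^-assocʳ (x + y) p (p ℕ.^ k) ⟨
      ((x + y) ^ p) ^ (p ℕ.^ k)                      ≈⟨ ^-congˡ (p ℕ.^ k) (^p-+ pp p≈0 x y) ⟩
      (x ^ p + y ^ p) ^ (p ℕ.^ k)                    ≈⟨ ^p^k-+ pp p≈0 k (x ^ p) (y ^ p) ⟩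
      (x ^ p) ^ (p ℕ.^ k) + (y ^ p) ^ (p ℕ.^ k)      ≈⟨ +-cong (^-assocʳ x p (p ℕ.^ k)) (^-assocʳ y p (p ℕ.^ k)) ⟩
      x ^ (p ℕ.* p ℕ.^ k) + y ^ (p ℕ.* p ℕ.^ k)      ∎

    -- The p^k-th power map applied twice is the q-th power map, which is the identity. So σ is its
    -- own inverse and y = σ z can be solved as z = σ y.
    ^-involutive : ∀ {p k} → q ≡ p ℕ.^ (2 ℕ.* k) → ∀ x → (x ^ (p ℕ.^ k)) ^ (p ℕ.^ k) ≈ x
    ^-involutive {p} {k} q≡p^2k x = begin
      (x ^ (p ℕ.^ k)) ^ (p ℕ.^ k)   ≈⟨ ^-assocʳ x (p ℕ.^ k) (p ℕ.^ k) ⟩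
      x ^ (p ℕ.^ k ℕ.* p ℕ.^ k)     ≡⟨ ≡.cong (x ^_) (ℕ.^-distribˡ-+-* p k k) ⟨
      x ^ (p ℕ.^ (k ℕ.+ k))         ≡⟨ ≡.cong (λ j → x ^ (p ℕ.^ (k ℕ.+ j))) (ℕ.+-identityʳ k) ⟨
      x ^ (p ℕ.^ (2 ℕ.* k))         ≡⟨ ≡.cong (x ^_) q≡p^2k ⟨
      x ^ q                         ≈⟨ x^q≈x x ⟩
      x                             ∎

  open ≡.≡-Reasoning
  open SumOver ℚ.+-0-commutativeMonoid using () renaming (sum-reindex to ∑-reindex)

  Congruent : (Carrier → ℚ) → Set _
  Congruent g = ∀ {x y} → x ≈ y → g x ≡ g y

  ∑F : (Carrier → ℚ) → ℚ
  ∑F g = ∑ℚ (g ∘ element)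

  ∑F-const : ∀ a → ∑F (λ _ → a) ≡ ι q ℚ.* a
  ∑F-const a = ∑-const q a

  ∑F-select : ∀ a (g : Carrier → ℚ) → Congruent g → ∑F (λ x → 𝟏 (x ≈? a) ℚ.* g x) ≡ g a
  ∑F-select a g g-cong = ≡.trans
    (sum-cong-≗ λ i → ≡.cong (ℚ._* g (element i)) (𝟏-cong (element i ≈? a) (i Fin.≟ index a)
      (λ eq → ≡.trans (≡.sym (index∘element i)) (index-cong eq))
      (λ eq → ≈-trans (reflexive (≡.cong element eq)) (element∘index a))))
    (≡.trans (∑-𝟏 (index a) (g ∘ element)) (g-cong (element∘index a)))

  ∑F-𝟏 : ∀ a → ∑F (λ x → 𝟏 (x ≈? a)) ≡ 1ℚ
  ∑F-𝟏 a = ≡.trans (sum-cong-≗ λ i → ≡.sym (ℚ.*-identityʳ (𝟏 (element i ≈? a))))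
    (∑F-select a (λ _ → 1ℚ) (λ _ → refl))

  -- The quadratic character

  [_∈Q] : Carrier → ℚ
  [ x ∈Q] = 𝟏 (nonzeroSquare? x)

  ∈Q-cong : Congruent [_∈Q]
  ∈Q-cong {x} {y} x≈y = 𝟏-cong (nonzeroSquare? x) (nonzeroSquare? y)
    (square-resp-≈ x≈y) (square-resp-≈ (≈-sym x≈y))

  [_≈0] : Carrier → ℚ
  [ x ≈0] = 𝟏 (x ≈? 0#)

  ≈0-cong : Congruent [_≈0]
  ≈0-cong {x} {y} x≈y = 𝟏-cong (x ≈? 0#) (y ≈? 0#) (≈-trans (≈-sym x≈y)) (≈-trans x≈y)

  -- The quadratic character as 2 [x ∈ Q] + [x = 0] - 1. In this affine form 2A = S + J - M holds
  -- entry by entry as a polynomial identity in the indicators.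
  χ : Carrier → ℚ
  χ x = ([ x ∈Q] ℚ.+ [ x ∈Q]) ℚ.+ [ x ≈0] ℚ.- 1ℚ

  χ-cong : Congruent χ
  χ-cong x≈y = ≡.cong₂ (λ s z → (s ℚ.+ s) ℚ.+ z ℚ.- 1ℚ) (∈Q-cong x≈y) (≈0-cong x≈y)

  χ-zero : ∀ {x} → x ≈ 0# → χ x ≡ 0ℚ
  χ-zero {x} x≈0 = ≡.cong₂ (λ s z → (s ℚ.+ s) ℚ.+ z ℚ.- 1ℚ)
    (𝟏-false (nonzeroSquare? x) (λ sq → square-≉0 sq x≈0)) (𝟏-true (x ≈? 0#) x≈0)

  χ-square : ∀ {x} → NonzeroSquare x → χ x ≡ 1ℚ
  χ-square {x} sq = ≡.cong₂ (λ s z → (s ℚ.+ s) ℚ.+ z ℚ.- 1ℚ)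
    (𝟏-true (nonzeroSquare? x) sq) (𝟏-false (x ≈? 0#) (square-≉0 sq))

  χ-nonsquare : ∀ {x} → ¬ (x ≈ 0#) → ¬ NonzeroSquare x → χ x ≡ ℚ.- 1ℚ
  χ-nonsquare {x} x≉0 ¬sq = ≡.cong₂ (λ s z → (s ℚ.+ s) ℚ.+ z ℚ.- 1ℚ)
    (𝟏-false (nonzeroSquare? x) ¬sq) (𝟏-false (x ≈? 0#) x≉0)

  data Class (x : Carrier) : Set (c ⊔ ℓ₁) where
    isZero      : x ≈ 0# → Class x
    isSquare    : NonzeroSquare x → Class x
    isNonsquare : ¬ (x ≈ 0#) → ¬ NonzeroSquare x → Class x

  classify : ∀ x → Class x
  classify x with x ≈? 0# | nonzeroSquare? x
  ... | yes x≈0 | _      = isZero x≈0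
  ... | no  _   | yes sq = isSquare sq
  ... | no  x≉0 | no ¬sq = isNonsquare x≉0 ¬sq

  χ*χ : ∀ x → χ x ℚ.* χ x ≡ 1ℚ ℚ.- [ x ≈0]
  χ*χ x with classify x
  ... | isZero x≈0          = ≡.trans (≡.cong (λ t → t ℚ.* t) (χ-zero x≈0))
                                (≡.sym (≡.cong (λ t → 1ℚ ℚ.- t) (𝟏-true (x ≈? 0#) x≈0)))
  ... | isSquare sq         = ≡.trans (≡.cong (λ t → t ℚ.* t) (χ-square sq))
                                (≡.sym (≡.cong (λ t → 1ℚ ℚ.- t) (𝟏-false (x ≈? 0#) (square-≉0 sq))))
  ... | isNonsquare x≉0 ¬sq = ≡.trans (≡.cong (λ t → t ℚ.* t) (χ-nonsquare x≉0 ¬sq))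
                                (≡.sym (≡.cong (λ t → 1ℚ ℚ.- t) (𝟏-false (x ≈? 0#) x≉0)))

  module Odd (q%4≡1 : q ℕ.% 4 ≡ 1) where

    -- The roots of a nonzero square z² are z and -z, which differ because 2 is nonzero; 0 has a
    -- single root and a nonsquare none.
    count-square-roots : ∀ y → ∑F (λ x → 𝟏 (y ≈? x * x)) ≡ 1ℚ ℚ.+ χ y
    count-square-roots y with classify y
    ... | isZero y≈0 = ≡.trans (sum-cong-≗ λ i → 𝟏-cong (y ≈? element i * element i) (element i ≈? 0#) (to i) (from i))
        (≡.trans (∑F-𝟏 0#) (≡.sym (≡.cong (1ℚ ℚ.+_) (χ-zero y≈0))))
      where
      to : ∀ i → y ≈ element i * element i → element i ≈ 0#
      to i eq with element i ≈? 0#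
      ... | yes x≈0 = x≈0
      ... | no  x≉0 = contradiction (≈-trans (≈-sym eq) y≈0) (*-≉0 x≉0 x≉0)
      from : ∀ i → element i ≈ 0# → y ≈ element i * element i
      from i x≈0 = ≈-trans y≈0 (≈-sym (≈-trans (*-congʳ x≈0) (zeroˡ (element i))))
    ... | isSquare sq@(z , z≉0 , y≈zz) = ≡.trans (sum-cong-≗ (two-roots ∘ element))
        (≡.trans (∑-distrib-+ (λ i → 𝟏 (element i ≈? z)) (λ i → 𝟏 (element i ≈? - z)))
        (≡.trans (≡.cong₂ ℚ._+_ (∑F-𝟏 z) (∑F-𝟏 (- z))) (≡.sym (≡.cong (1ℚ ℚ.+_) (χ-square sq)))))
      where
      two-roots : ∀ x → 𝟏 (y ≈? x * x) ≡ 𝟏 (x ≈? z) ℚ.+ 𝟏 (x ≈? - z)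
      two-roots x with x ≈? z | x ≈? - z
      ... | yes x≈z | yes x≈-z = contradiction (≈-trans (≈-sym x≈z) x≈-z) (x≉-x q%4≡1 z≉0)
      ... | yes x≈z | no _     = 𝟏-true (y ≈? x * x) (≈-trans y≈zz (≈-sym (*-cong x≈z x≈z)))
      ... | no _    | yes x≈-z = 𝟏-true (y ≈? x * x)
        (≈-trans y≈zz (≈-trans (≈-sym (-x*-x≈x*x z)) (≈-sym (*-cong x≈-z x≈-z))))
      ... | no x≉z  | no x≉-z  = 𝟏-false (y ≈? x * x) λ eq →
        Sum.[ x≉z , x≉-z ] (square-roots (≈-trans (≈-sym eq) y≈zz))
    ... | isNonsquare y≉0 ¬sq = ≡.trans
        (sum-cong-≗ λ i → 𝟏-false (y ≈? element i * element i) (no-root (element i)))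
        (≡.trans (≡.trans (∑F-const 0ℚ) (ℚ.*-zeroʳ (ι q))) (≡.sym (≡.cong (1ℚ ℚ.+_) (χ-nonsquare y≉0 ¬sq))))
      where
      no-root : ∀ x → ¬ (y ≈ x * x)
      no-root x eq = ¬sq (x , (λ x≈0 → y≉0 (≈-trans eq (≈-trans (*-congʳ x≈0) (zeroˡ x)))) , eq)

    -- The pairs (x, y) with y = x² are counted twice: there are q of them by x, and q + ∑ χ of them
    -- by y.
    ∑χ≡0 : ∑F χ ≡ 0ℚ
    ∑χ≡0 = begin
      ∑F χ
        ≡⟨ solve 2 (λ q x → x := (q :+ x) :- q) refl (ι q ℚ.* 1ℚ) (∑F χ) ⟩
      (ι q ℚ.* 1ℚ ℚ.+ ∑F χ) ℚ.- ι q ℚ.* 1ℚ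
        ≡⟨ ≡.cong (λ t → t ℚ.+ ∑F χ ℚ.- ι q ℚ.* 1ℚ) (≡.sym (∑F-const 1ℚ)) ⟩
      (∑F (λ _ → 1ℚ) ℚ.+ ∑F χ) ℚ.- ι q ℚ.* 1ℚ
        ≡⟨ ≡.cong (ℚ._- ι q ℚ.* 1ℚ) (≡.sym (∑-distrib-+ {q} (λ _ → 1ℚ) (χ ∘ element))) ⟩
      ∑F (λ y → 1ℚ ℚ.+ χ y) ℚ.- ι q ℚ.* 1ℚ
        ≡⟨ ≡.cong (ℚ._- ι q ℚ.* 1ℚ) (sum-cong-≗ λ i → ≡.sym (count-square-roots (element i))) ⟩
      ∑F (λ y → ∑F (λ x → 𝟏 (y ≈? x * x))) ℚ.- ι q ℚ.* 1ℚ
        ≡⟨ ≡.cong (ℚ._- ι q ℚ.* 1ℚ) (∑-comm (λ i j → 𝟏 (element i ≈? element j * element j))) ⟩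
      ∑F (λ x → ∑F (λ y → 𝟏 (y ≈? x * x))) ℚ.- ι q ℚ.* 1ℚ
        ≡⟨ ≡.cong (ℚ._- ι q ℚ.* 1ℚ) (sum-cong-≗ λ i → ∑F-𝟏 (element i * element i)) ⟩
      ∑F (λ _ → 1ℚ) ℚ.- ι q ℚ.* 1ℚ
        ≡⟨ ≡.cong (ℚ._- ι q ℚ.* 1ℚ) (∑F-const 1ℚ) ⟩
      ι q ℚ.* 1ℚ ℚ.- ι q ℚ.* 1ℚ
        ≡⟨ ℚ.+-inverseʳ (ι q ℚ.* 1ℚ) ⟩
      0ℚ ∎

    χ-square-* : ∀ {s} → NonzeroSquare s → ∀ x → χ (s * x) ≡ χ x
    χ-square-* {s} sq x with classify x
    ... | isZero x≈0  = ≡.trans (χ-zero (≈-trans (*-congˡ x≈0) (zeroʳ s))) (≡.sym (χ-zero x≈0))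
    ... | isSquare sq′ = ≡.trans (χ-square (square-* sq sq′)) (≡.sym (χ-square sq′))
    ... | isNonsquare x≉0 ¬sq = ≡.trans
      (χ-nonsquare (*-≉0 (square-≉0 sq) x≉0) (¬sq ∘ square-cancelˡ sq)) (≡.sym (χ-nonsquare x≉0 ¬sq))

    -- The summands χ (n x) + χ x are nonpositive and add up to zero.
    χ-nonsquare-* : ∀ {n} → ¬ (n ≈ 0#) → ¬ NonzeroSquare n → ∀ x → χ (n * x) ℚ.+ χ x ≡ 0ℚ
    χ-nonsquare-* {n} n≉0 ¬sq x = ≡.trans
      (≡.cong₂ ℚ._+_ (χ-cong (*-congˡ (≈-sym (element∘index x)))) (χ-cong (≈-sym (element∘index x))))
      (∑-nonPos-zero (nonPos ∘ element) total (index x))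
      where
      nonPos : ∀ x → χ (n * x) ℚ.+ χ x ℚ.≤ 0ℚ
      nonPos x with classify x
      ... | isZero x≈0 = ℚ.≤-reflexive
        (≡.cong₂ ℚ._+_ (χ-zero (≈-trans (*-congˡ x≈0) (zeroʳ n))) (χ-zero x≈0))
      ... | isSquare sq = ℚ.≤-reflexive (≡.cong₂ ℚ._+_
        (χ-nonsquare (*-≉0 n≉0 (square-≉0 sq))
          (λ sq′ → ¬sq (square-cancelˡ sq (square-resp-≈ (*-comm n x) sq′))))
        (χ-square sq))
      ... | isNonsquare x≉0 ¬sq′ with classify (n * x)
      ...   | isZero nx≈0      = contradiction nx≈0 (*-≉0 n≉0 x≉0)
      ...   | isSquare sq      = ℚ.≤-reflexive (≡.cong₂ ℚ._+_ (χ-square sq) (χ-nonsquare x≉0 ¬sq′))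
      -- The possibility that a product of two nonsquares is a nonsquare is not excluded here: the
      -- summand would be -2, which is still nonpositive. The zero total excludes it afterwards.
      ...   | isNonsquare nx≉0 ¬sq″ = ℚ.≤-trans
        (ℚ.≤-reflexive (≡.cong₂ ℚ._+_ (χ-nonsquare nx≉0 ¬sq″) (χ-nonsquare x≉0 ¬sq′)))
        (ℚ.nonPositive⁻¹ (ℚ.- 1ℚ ℚ.+ ℚ.- 1ℚ))
      total : ∑F (λ x → χ (n * x) ℚ.+ χ x) ≡ 0ℚ
      total = ≡.trans (∑-distrib-+ (λ i → χ (n * element i)) (χ ∘ element)) (≡.cong₂ ℚ._+_
        (≡.trans (≡.sym (≡.trans (∑-reindex (scaling n≉0) χ χ-cong)
          (sum-cong-≗ λ i → ≡.cong χ (scaling-to n≉0 (element i))))) ∑χ≡0) ∑χ≡0)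

    χ-* : ∀ x y → χ (x * y) ≡ χ x ℚ.* χ y
    χ-* x y with classify x
    ... | isZero x≈0  = ≡.trans (χ-zero (≈-trans (*-congʳ x≈0) (zeroˡ y)))
      (≡.sym (≡.trans (≡.cong (ℚ._* χ y) (χ-zero x≈0)) (ℚ.*-zeroˡ (χ y))))
    ... | isSquare sq = ≡.trans (χ-square-* sq y)
      (≡.sym (≡.trans (≡.cong (ℚ._* χ y) (χ-square sq)) (ℚ.*-identityˡ (χ y))))
    ... | isNonsquare x≉0 ¬sq = begin
      χ (x * y)                         ≡⟨ solve 2 (λ a b → a := (a :+ b) :- b) refl (χ (x * y)) (χ y) ⟩
      (χ (x * y) ℚ.+ χ y) ℚ.- χ y       ≡⟨ ≡.cong (ℚ._- χ y) (χ-nonsquare-* x≉0 ¬sq y) ⟩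
      0ℚ ℚ.- χ y                        ≡⟨ solve 1 (λ b → con 0ℚ :- b := (:- con 1ℚ) :* b) refl (χ y) ⟩
      ℚ.- 1ℚ ℚ.* χ y                    ≡⟨ ≡.cong (ℚ._* χ y) (≡.sym (χ-nonsquare x≉0 ¬sq)) ⟩
      χ x ℚ.* χ y                       ∎

    -- For t ≉ 0 the summand is χ (1 + a / t), as χ t * χ t = 1.
    jacobsthal : ∀ {a} → ¬ (a ≈ 0#) → ∑F (λ t → χ t ℚ.* χ (a + t)) ≡ ℚ.- 1ℚ
    jacobsthal {a} a≉0 = begin
      ∑F (λ t → χ t ℚ.* χ (a + t))
        ≡⟨ sum-cong-≗ (summand ∘ element) ⟩
      ∑F (λ t → χ (1# + a * t ⁻¹) ℚ.- [ t ≈0])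
        ≡⟨ ∑-distrib-sub (λ i → χ (1# + a * element i ⁻¹)) (λ i → [ element i ≈0]) ⟩
      ∑F (λ t → χ (1# + a * t ⁻¹)) ℚ.- ∑F [_≈0]
        ≡⟨ ≡.cong₂ ℚ._-_ reindexed (∑F-𝟏 0#) ⟩
      0ℚ ℚ.- 1ℚ
        ≡⟨⟩
      ℚ.- 1ℚ ∎
      where
      -- The map sending t to 1 + a / t is a composite of inversion, scaling and translation, so the
      -- sum is that of χ over the whole field.
      reindexed : ∑F (λ t → χ (1# + a * t ⁻¹)) ≡ 0ℚ
      reindexed = begin
        ∑F (λ t → χ (1# + a * t ⁻¹))
          ≡⟨ ∑-reindex inversion (λ t → χ (1# + a * t)) (λ eq → χ-cong (+-congˡ (*-congˡ eq))) ⟨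
        ∑F (λ t → χ (1# + a * t))
          ≡⟨ sum-cong-≗ (λ i → ≡.cong (λ t → χ (1# + t)) (scaling-to a≉0 (element i))) ⟨
        ∑F (λ t → χ (1# + Inverse.to (scaling a≉0) t))
          ≡⟨ ∑-reindex (scaling a≉0) (λ t → χ (1# + t)) (λ eq → χ-cong (+-congˡ eq)) ⟨
        ∑F (λ t → χ (1# + t))
          ≡⟨ ∑-reindex (translation 1#) χ χ-cong ⟨
        ∑F χ
          ≡⟨ ∑χ≡0 ⟩
        0ℚ ∎
      summand : ∀ t → χ t ℚ.* χ (a + t) ≡ χ (1# + a * t ⁻¹) ℚ.- [ t ≈0]
      summand t = summand′ (t ≈? 0#)
        where
        summand′ : Dec (t ≈ 0#) → χ t ℚ.* χ (a + t) ≡ χ (1# + a * t ⁻¹) ℚ.- [ t ≈0]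
        -- At t = 0 the convention for the inverse of 0 makes the first term χ 1 = 1, and the
        -- indicator removes it.
        summand′ (yes t≈0) = begin
          χ t ℚ.* χ (a + t)             ≡⟨ ≡.cong (ℚ._* χ (a + t)) (χ-zero t≈0) ⟩
          0ℚ ℚ.* χ (a + t)              ≡⟨ ℚ.*-zeroˡ (χ (a + t)) ⟩
          1ℚ ℚ.- 1ℚ                     ≡⟨ ≡.cong₂ ℚ._-_ (χ-square square-1) (𝟏-true (t ≈? 0#) t≈0) ⟨
          χ 1# ℚ.- [ t ≈0]              ≡⟨ ≡.cong (ℚ._- [ t ≈0]) (χ-cong (≈-trans (+-congˡ
                                             (≈-trans (*-congˡ (reflexive (⁻¹-zero t≈0))) (zeroʳ a))) (+-identityʳ 1#))) ⟨
          χ (1# + a * t ⁻¹) ℚ.- [ t ≈0] ∎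
        summand′ (no t≉0) = begin
          χ t ℚ.* χ (a + t)
            ≡⟨ ≡.cong (χ t ℚ.*_) (χ-cong (+-factor a (*-⁻¹ t≉0))) ⟩
          χ t ℚ.* χ (t * (1# + a * t ⁻¹))
            ≡⟨ ≡.cong (χ t ℚ.*_) (χ-* t (1# + a * t ⁻¹)) ⟩
          χ t ℚ.* (χ t ℚ.* χ (1# + a * t ⁻¹))
            ≡⟨ ℚ.*-assoc (χ t) (χ t) (χ (1# + a * t ⁻¹)) ⟨
          χ t ℚ.* χ t ℚ.* χ (1# + a * t ⁻¹)
            ≡⟨ ≡.cong (ℚ._* χ (1# + a * t ⁻¹)) (χ*χ t) ⟩
          (1ℚ ℚ.- [ t ≈0]) ℚ.* χ (1# + a * t ⁻¹)
            ≡⟨ ≡.cong (λ z → (1ℚ ℚ.- z) ℚ.* χ (1# + a * t ⁻¹)) (𝟏-false (t ≈? 0#) t≉0) ⟩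
          (1ℚ ℚ.- 0ℚ) ℚ.* χ (1# + a * t ⁻¹)
            ≡⟨ solve 1 (λ x → (con 1ℚ :- con 0ℚ) :* x := x :- con 0ℚ) refl (χ (1# + a * t ⁻¹)) ⟩
          χ (1# + a * t ⁻¹) ℚ.- 0ℚ
            ≡⟨ ≡.cong (λ z → χ (1# + a * t ⁻¹) ℚ.- z) (𝟏-false (t ≈? 0#) t≉0) ⟨
          χ (1# + a * t ⁻¹) ℚ.- [ t ≈0] ∎

    -- Translation by a leaves a sum that depends only on b - a: a Jacobsthal sum if b - a is
    -- nonzero, and otherwise the sum of χ², which counts the q - 1 nonzero elements.
    χ-correlation : ∀ a b → ∑F (λ t → χ (a + t) ℚ.* χ (b + t)) ≡ ι q ℚ.* 𝟏 (a ≈? b) ℚ.- 1ℚ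
    χ-correlation a b with a ≈? b
    ... | yes a≈b = begin
      ∑F (λ t → χ (a + t) ℚ.* χ (b + t))
        ≡⟨ sum-cong-≗ (λ i → ≡.cong (χ (a + element i) ℚ.*_) (χ-cong (+-congʳ (≈-sym a≈b)))) ⟩
      ∑F (λ t → χ (a + t) ℚ.* χ (a + t))
        ≡⟨ ∑-reindex (translation a) (λ t → χ t ℚ.* χ t) (λ eq → ≡.cong (λ z → z ℚ.* z) (χ-cong eq)) ⟨
      ∑F (λ t → χ t ℚ.* χ t)
        ≡⟨ sum-cong-≗ (χ*χ ∘ element) ⟩
      ∑F (λ t → 1ℚ ℚ.- [ t ≈0])
        ≡⟨ ∑-distrib-sub (λ _ → 1ℚ) (λ i → [ element i ≈0]) ⟩
      ∑F (λ _ → 1ℚ) ℚ.- ∑F [_≈0]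
        ≡⟨ ≡.cong₂ ℚ._-_ (∑F-const 1ℚ) (∑F-𝟏 0#) ⟩
      ι q ℚ.* 1ℚ ℚ.- 1ℚ ∎
    ... | no a≉b = begin
      ∑F (λ t → χ (a + t) ℚ.* χ (b + t))
        ≡⟨ sum-cong-≗ (λ i → ≡.cong (χ (a + element i) ℚ.*_) (χ-cong (+-telescope a b (element i)))) ⟩
      ∑F (λ t → χ (a + t) ℚ.* χ ((b - a) + (a + t)))
        ≡⟨ ∑-reindex (translation a) (λ t → χ t ℚ.* χ ((b - a) + t))
             (λ eq → ≡.cong₂ ℚ._*_ (χ-cong eq) (χ-cong (+-congˡ eq))) ⟨
      ∑F (λ t → χ t ℚ.* χ ((b - a) + t))
        ≡⟨ jacobsthal (λ b-a≈0 → a≉b (≈-sym (x∙y⁻¹≈ε⇒x≈y b a b-a≈0))) ⟩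
      ℚ.- 1ℚ
        ≡⟨ ≡.trans (≡.cong (ℚ._- 1ℚ) (ℚ.*-zeroʳ (ι q))) (ℚ.+-identityˡ (ℚ.- 1ℚ)) ⟨
      ι q ℚ.* 0ℚ ℚ.- 1ℚ ∎

    -- Consecutive squares and the square root of -1

    ∑F[1+χ][1+χ] : ∑F (λ t → (1ℚ ℚ.+ χ t) ℚ.* (1ℚ ℚ.+ χ (1# + t))) ≡ ι q ℚ.- 1ℚ
    ∑F[1+χ][1+χ] = begin
      ∑F (λ t → (1ℚ ℚ.+ χ t) ℚ.* (1ℚ ℚ.+ χ (1# + t)))
        ≡⟨ sum-cong-≗ (λ i → solve 2 (λ a b → (con 1ℚ :+ a) :* (con 1ℚ :+ b) := con 1ℚ :+ (a :+ (b :+ a :* b))) refl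
             (χ (element i)) (χ (1# + element i))) ⟩
      ∑F (λ t → 1ℚ ℚ.+ (χ t ℚ.+ (χ (1# + t) ℚ.+ χ t ℚ.* χ (1# + t))))
        ≡⟨ ≡.trans (∑-distrib-+ {q} (λ _ → 1ℚ) _) (≡.cong (∑F (λ _ → 1ℚ) ℚ.+_)
             (≡.trans (∑-distrib-+ (χ ∘ element) _) (≡.cong (∑F χ ℚ.+_)
               (∑-distrib-+ (λ i → χ (1# + element i)) _)))) ⟩
      ∑F (λ _ → 1ℚ) ℚ.+ (∑F χ ℚ.+ (∑F (λ t → χ (1# + t)) ℚ.+ ∑F (λ t → χ t ℚ.* χ (1# + t))))
        ≡⟨ ≡.cong₂ ℚ._+_ (≡.trans (∑F-const 1ℚ) (ℚ.*-identityʳ (ι q)))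
             (≡.cong₂ ℚ._+_ ∑χ≡0 (≡.cong₂ ℚ._+_
               (≡.trans (≡.sym (∑-reindex (translation 1#) χ χ-cong)) ∑χ≡0) (jacobsthal 1≉0))) ⟩
      ι q ℚ.+ (0ℚ ℚ.+ (0ℚ ℚ.+ ℚ.- 1ℚ))
        ≡⟨⟩
      ι q ℚ.- 1ℚ ∎

    consecutiveSquares : ℕ
    consecutiveSquares =
      count (λ i → nonzeroSquare? (element i) ×-dec nonzeroSquare? (1# + element i)) (allFin q)

    -- (1 + χ t) (1 + χ (1 + t)) is 4 when t and 1 + t are nonzero squares, and 0 for all other t
    -- except t = 0 and possibly t = -1.
    4*consecutiveSquares : ι 4 ℚ.* ι consecutiveSquares ℚ.+ (ι 2 ℚ.+ ι 2 ℚ.* [ - 1# ∈Q]) ≡ ι q ℚ.- 1ℚ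
    4*consecutiveSquares = begin
      ι 4 ℚ.* ι consecutiveSquares ℚ.+ (ι 2 ℚ.+ ι 2 ℚ.* [ - 1# ∈Q])
        ≡⟨ ≡.cong₂ ℚ._+_ four (≡.cong₂ ℚ._+_ (≡.sym at-0) (≡.sym at-[-1])) ⟩
      ∑F both ℚ.+ (∑F zero-left ℚ.+ ∑F zero-right)
        ≡⟨ ≡.trans (∑-distrib-+ (both ∘ element) _)
             (≡.cong (∑F both ℚ.+_) (∑-distrib-+ (zero-left ∘ element) (zero-right ∘ element))) ⟨
      ∑F (λ t → both t ℚ.+ (zero-left t ℚ.+ zero-right t))
        ≡⟨ sum-cong-≗ (summand ∘ element) ⟨
      ∑F (λ t → (1ℚ ℚ.+ χ t) ℚ.* (1ℚ ℚ.+ χ (1# + t)))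
        ≡⟨ ∑F[1+χ][1+χ] ⟩
      ι q ℚ.- 1ℚ ∎
      where
      both zero-left zero-right : Carrier → ℚ
      both t       = ι 4 ℚ.* ([ t ∈Q] ℚ.* [ 1# + t ∈Q])
      zero-left t  = [ t ≈0] ℚ.* (1ℚ ℚ.+ χ (1# + t))
      zero-right t = 𝟏 (t ≈? - 1#) ℚ.* (ι 2 ℚ.* [ t ∈Q])
      four : ι 4 ℚ.* ι consecutiveSquares ≡ ∑F both
      four = ≡.trans
        (≡.cong (ι 4 ℚ.*_) (≡.trans
          (ι-count (λ i → nonzeroSquare? (element i) ×-dec nonzeroSquare? (1# + element i)) id)
          (sum-cong-≗ λ i → 𝟏-×-dec (nonzeroSquare? (element i)) (nonzeroSquare? (1# + element i)))))
        (*-distribˡ-sum (ι 4) (λ i → [ element i ∈Q] ℚ.* [ 1# + element i ∈Q]))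
      at-0 : ∑F zero-left ≡ ι 2
      at-0 = ≡.trans
        (∑F-select 0# (λ t → 1ℚ ℚ.+ χ (1# + t)) (λ eq → ≡.cong (1ℚ ℚ.+_) (χ-cong (+-congˡ eq))))
        (≡.cong (1ℚ ℚ.+_) (≡.trans (χ-cong (+-identityʳ 1#)) (χ-square square-1)))
      at-[-1] : ∑F zero-right ≡ ι 2 ℚ.* [ - 1# ∈Q]
      at-[-1] = ∑F-select (- 1#) (λ t → ι 2 ℚ.* [ t ∈Q]) (λ eq → ≡.cong (ι 2 ℚ.*_) (∈Q-cong eq))
      summand : ∀ t → (1ℚ ℚ.+ χ t) ℚ.* (1ℚ ℚ.+ χ (1# + t)) ≡ both t ℚ.+ (zero-left t ℚ.+ zero-right t)
      summand t = begin
        (1ℚ ℚ.+ χ t) ℚ.* (1ℚ ℚ.+ χ (1# + t))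
          -- The factors are 2s + z and 2s′ + z′. Their product is 4 s s′ + z (2s′ + z′) + 2 s z′,
          -- so the product of the two zero indicators is booked under `zero-left`.
          ≡⟨ solve 4 (λ s z s′ z′ →
               (con 1ℚ :+ ((s :+ s) :+ z :- con 1ℚ)) :* (con 1ℚ :+ ((s′ :+ s′) :+ z′ :- con 1ℚ))
               := con (ι 4) :* (s :* s′)
                  :+ (z :* (con 1ℚ :+ ((s′ :+ s′) :+ z′ :- con 1ℚ)) :+ z′ :* (con (ι 2) :* s)))
               refl [ t ∈Q] [ t ≈0] [ 1# + t ∈Q] [ 1# + t ≈0] ⟩
        both t ℚ.+ (zero-left t ℚ.+ [ 1# + t ≈0] ℚ.* (ι 2 ℚ.* [ t ∈Q]))
          ≡⟨ ≡.cong (λ z → both t ℚ.+ (zero-left t ℚ.+ z ℚ.* (ι 2 ℚ.* [ t ∈Q])))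
               (𝟏-cong (1# + t ≈? 0#) (t ≈? - 1#) (+-inverseʳ-unique 1# t)
                 (λ eq → ≈-trans (+-congˡ eq) (-‿inverseʳ 1#))) ⟩
        both t ℚ.+ (zero-left t ℚ.+ zero-right t) ∎

    -- If -1 were not a square, the count of consecutive squares would read 4N + 2 = q - 1, so q ≡ 3
    -- mod 4.
    square-[-1] : NonzeroSquare (- 1#)
    square-[-1] with nonzeroSquare? (- 1#)
    ... | yes sq = sq
    ... | no ¬sq = contradiction (≡.trans (≡.sym q%4≡3) q%4≡1) λ ()
      where
      N = consecutiveSquares
      ιq≡ι[3+4N] : ι q ≡ ι (3 ℕ.+ N ℕ.* 4)
      ιq≡ι[3+4N] = begin
        ι q
          ≡⟨ solve 1 (λ q → q := (q :- con 1ℚ) :+ con 1ℚ) refl (ι q) ⟩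
        (ι q ℚ.- 1ℚ) ℚ.+ 1ℚ
          ≡⟨ ≡.cong (ℚ._+ 1ℚ) 4*consecutiveSquares ⟨
        (ι 4 ℚ.* ι N ℚ.+ (ι 2 ℚ.+ ι 2 ℚ.* [ - 1# ∈Q])) ℚ.+ 1ℚ
          ≡⟨ ≡.cong (λ s → (ι 4 ℚ.* ι N ℚ.+ (ι 2 ℚ.+ ι 2 ℚ.* s)) ℚ.+ 1ℚ) (𝟏-false (nonzeroSquare? (- 1#)) ¬sq) ⟩
        (ι 4 ℚ.* ι N ℚ.+ (ι 2 ℚ.+ ι 2 ℚ.* 0ℚ)) ℚ.+ 1ℚ
          ≡⟨ solve 1 (λ n → (con (ι 4) :* n :+ (con (ι 2) :+ con (ι 2) :* con 0ℚ)) :+ con 1ℚ := con (ι 3) :+ n :* con (ι 4)) refl (ι N) ⟩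
        ι 3 ℚ.+ ι N ℚ.* ι 4
          ≡⟨ ≡.cong (ι 3 ℚ.+_) (ι-* N 4) ⟨
        ι 3 ℚ.+ ι (N ℕ.* 4)
          ≡⟨ ι-+ 3 (N ℕ.* 4) ⟨
        ι (3 ℕ.+ N ℕ.* 4) ∎
      q%4≡3 : q ℕ.% 4 ≡ 3
      q%4≡3 = ≡.trans (≡.cong (ℕ._% 4) (ι-injective {q} {3 ℕ.+ N ℕ.* 4} ιq≡ι[3+4N])) (ℕ.[m+kn]%n≡m%n 3 N 4)

    -- The degree and graphs given by a square condition

    ∣Q∣ : ℕ
    ∣Q∣ = count (λ i → nonzeroSquare? (element i)) (allFin q)

    ι-∣Q∣ : ι ∣Q∣ ≡ ∑F [_∈Q]
    ι-∣Q∣ = ι-count (λ i → nonzeroSquare? (element i)) id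

    -- The expression [x = 0] + 2 [x ∈ Q] equals χ x + 1, and χ sums to 0.
    1+2∣Q∣≡q : 1 ℕ.+ (∣Q∣ ℕ.+ ∣Q∣) ≡ q
    1+2∣Q∣≡q = ι-injective (begin
      ι (1 ℕ.+ (∣Q∣ ℕ.+ ∣Q∣))
        ≡⟨ ≡.trans (ι-+ 1 (∣Q∣ ℕ.+ ∣Q∣)) (≡.cong (1ℚ ℚ.+_) (ι-+ ∣Q∣ ∣Q∣)) ⟩
      1ℚ ℚ.+ (ι ∣Q∣ ℚ.+ ι ∣Q∣)
        ≡⟨ ≡.cong₂ (λ z s → z ℚ.+ (s ℚ.+ s)) (≡.sym (∑F-𝟏 0#)) ι-∣Q∣ ⟩
      ∑F [_≈0] ℚ.+ (∑F [_∈Q] ℚ.+ ∑F [_∈Q])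
        ≡⟨ ≡.trans (∑-distrib-+ (λ i → [ element i ≈0]) _)
             (≡.cong (∑F [_≈0] ℚ.+_) (∑-distrib-+ (λ i → [ element i ∈Q]) (λ i → [ element i ∈Q]))) ⟨
      ∑F (λ x → [ x ≈0] ℚ.+ ([ x ∈Q] ℚ.+ [ x ∈Q]))
        ≡⟨ sum-cong-≗ (λ i → solve 2 (λ s z → z :+ (s :+ s) := ((s :+ s) :+ z :- con 1ℚ) :+ con 1ℚ) refl
             [ element i ∈Q] [ element i ≈0]) ⟩
      ∑F (λ x → χ x ℚ.+ 1ℚ)
        ≡⟨ ∑-distrib-+ (χ ∘ element) (λ _ → 1ℚ) ⟩
      ∑F χ ℚ.+ ∑F (λ _ → 1ℚ)
        ≡⟨ ≡.cong₂ ℚ._+_ ∑χ≡0 (≡.trans (∑F-const 1ℚ) (ℚ.*-identityʳ (ι q))) ⟩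
      0ℚ ℚ.+ ι q
        ≡⟨ ℚ.+-identityˡ (ι q) ⟩
      ι q ∎)

    -- No nonzero squares would mean q = 1, where 0 and 1 coincide; a single one would mean q = 3.
    -- Degree at least 2 is what the final numerical inequality needs.
    2≤∣Q∣ : 2 ℕ.≤ ∣Q∣
    2≤∣Q∣ = go ∣Q∣ 1+2∣Q∣≡q
      where
      Fin1-irrelevant : ∀ {n} → 1 ≡ n → (i j : Fin n) → i ≡ j
      Fin1-irrelevant refl zero zero = refl
      go : ∀ k → 1 ℕ.+ (k ℕ.+ k) ≡ q → 2 ℕ.≤ k
      go zero          eq = contradiction
        (≈-trans (≈-sym (element∘index 1#)) (≈-trans
          (reflexive (≡.cong element (Fin1-irrelevant eq (index 1#) (index 0#)))) (element∘index 0#))) 1≉0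
      go (suc zero)    eq = contradiction (≡.trans (≡.cong (ℕ._% 4) eq) q%4≡1) λ ()
      go (suc (suc k)) eq = ℕ.s≤s (ℕ.s≤s ℕ.z≤n)

    -- At most one label s leads from vertex i to vertex j, namely t, so the multiplicity of the
    -- edge is the indicator of t being a nonzero square.
    ι-edges : ∀ f i j t → (∀ {s} → f s (element i) ≈ element j → s ≈ t) →
      (∀ {s} → s ≈ t → f s (element i) ≈ element j) → ι (edges f i j) ≡ [ t ∈Q]
    ι-edges f i j t f⇒ f⇐ = begin
      ι (edges f i j)
        ≡⟨ ι-edges-count ⟩
      ∑F (λ s → 𝟏 (nonzeroSquare? s ×-dec (f s (element i) ≈? element j)))
        ≡⟨ sum-cong-≗ (λ k → let s = element k in ≡.trans
             (𝟏-×-dec (nonzeroSquare? s) (f s (element i) ≈? element j))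
             (≡.trans (ℚ.*-comm [ s ∈Q] (𝟏 (f s (element i) ≈? element j)))
               (≡.cong (ℚ._* [ s ∈Q]) (𝟏-cong (f s (element i) ≈? element j) (s ≈? t) f⇒ f⇐)))) ⟩
      ∑F (λ s → 𝟏 (s ≈? t) ℚ.* [ s ∈Q])
        ≡⟨ ∑F-select t [_∈Q] ∈Q-cong ⟩
      [ t ∈Q] ∎
      where
      edge? = λ s → nonzeroSquare? (element s) ×-dec (f (element s) (element i) ≈? element j)
      edges≡count : edges f i j ≡ count edge? (allFin q)
      edges≡count = refl
      ι-edges-count : ι (edges f i j) ≡ ∑ℚ (λ s → 𝟏 (edge? s))
      ι-edges-count = ≡.trans (≡.cong ι edges≡count) (ι-count edge? id)

    -- All three graphs have an edge from x to y exactly if τ y + ρ x is a nonzero square.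
    module SquareGraph (A : Graph q) (τ ρ : Bijection)
      (ι-A : ∀ i j → ι (A i j) ≡ [ Inverse.to τ (element j) + Inverse.to ρ (element i) ∈Q])
      (transpose : ∀ x y → NonzeroSquare (Inverse.to τ y + Inverse.to ρ x) →
                           NonzeroSquare (Inverse.to τ x + Inverse.to ρ y))
      where
      private
        module τ = Inverse τ
        module ρ = Inverse ρ
        B : Fin q → Fin q → Carrier
        B i j = τ.to (element j) + ρ.to (element i)

      undirected : Undirected A
      undirected i j = ι-injective (≡.trans (ι-A i j) (≡.trans
        (𝟏-cong (nonzeroSquare? (B i j)) (nonzeroSquare? (B j i))
          (transpose (element i) (element j)) (transpose (element j) (element i)))
        (≡.sym (ι-A j i))))

      regular : Regular ∣Q∣ A
      regular i = ι-injective (begin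
        ι (∑ℕ (A i))
          ≡⟨ ι-∑ (A i) ⟩
        ∑ℚ (λ j → ι (A i j))
          ≡⟨ sum-cong-≗ (ι-A i) ⟩
        ∑F (λ y → [ τ.to y + ρ.to (element i) ∈Q])
          ≡⟨ ∑-reindex τ (λ y → [ y + ρ.to (element i) ∈Q]) (λ eq → ∈Q-cong (+-congʳ eq)) ⟨
        ∑F (λ y → [ y + ρ.to (element i) ∈Q])
          ≡⟨ sum-cong-≗ (λ j → ∈Q-cong (+-comm (element j) (ρ.to (element i)))) ⟩
        ∑F (λ y → [ ρ.to (element i) + y ∈Q])
          ≡⟨ ∑-reindex (translation (ρ.to (element i))) [_∈Q] ∈Q-cong ⟨
        ∑F [_∈Q]
          ≡⟨ ι-∣Q∣ ⟨
        ι ∣Q∣ ∎)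

      τ-injective : ∀ {x y} → τ.to x ≈ τ.to y → x ≈ y
      τ-injective {x} {y} eq =
        ≈-trans (≈-sym (τ.strictlyInverseʳ x)) (≈-trans (τ.from-cong eq) (τ.strictlyInverseʳ y))

      χ-gram : ∀ j k → ∑ℚ (λ i → χ (B i j) ℚ.* χ (B i k)) ≡ ι q ℚ.* 𝟏 (j Fin.≟ k) ℚ.- 1ℚ
      χ-gram j k = begin
        ∑F (λ x → χ (a + ρ.to x) ℚ.* χ (b + ρ.to x))
          ≡⟨ ∑-reindex ρ (λ t → χ (a + t) ℚ.* χ (b + t))
               (λ eq → ≡.cong₂ ℚ._*_ (χ-cong (+-congˡ eq)) (χ-cong (+-congˡ eq))) ⟨
        ∑F (λ t → χ (a + t) ℚ.* χ (b + t))
          ≡⟨ χ-correlation a b ⟩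
        ι q ℚ.* 𝟏 (a ≈? b) ℚ.- 1ℚ
          ≡⟨ ≡.cong (λ z → ι q ℚ.* z ℚ.- 1ℚ) (𝟏-cong (a ≈? b) (j Fin.≟ k)
               (λ eq → element-injective (τ-injective eq)) (λ { refl → ≈-refl })) ⟩
        ι q ℚ.* 𝟏 (j Fin.≟ k) ℚ.- 1ℚ ∎
        where
        a = τ.to (element j)
        b = τ.to (element k)

      -- The columns of a permutation matrix are orthonormal: column j has its only 1 where ρ x = -τ
      -- y, with y the element of index j. The trivial terms bring the identity matrix into the
      -- shape α I - β J.
      ≈0-gram : ∀ j k → ∑ℚ (λ i → [ B i j ≈0] ℚ.* [ B i k ≈0]) ≡ 1ℚ ℚ.* 𝟏 (j Fin.≟ k) ℚ.- 0ℚ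
      ≈0-gram j k = begin
        ∑F (λ x → [ a + ρ.to x ≈0] ℚ.* [ b + ρ.to x ≈0])
          ≡⟨ ∑-reindex ρ (λ t → [ a + t ≈0] ℚ.* [ b + t ≈0])
               (λ eq → ≡.cong₂ ℚ._*_ (≈0-cong (+-congˡ eq)) (≈0-cong (+-congˡ eq))) ⟨
        ∑F (λ t → [ a + t ≈0] ℚ.* [ b + t ≈0])
          ≡⟨ sum-cong-≗ (λ i → ≡.cong (ℚ._* [ b + element i ≈0])
               (𝟏-cong (a + element i ≈? 0#) (element i ≈? - a) (+-inverseʳ-unique a (element i))
                 (λ eq → ≈-trans (+-congˡ eq) (-‿inverseʳ a)))) ⟩
        ∑F (λ t → 𝟏 (t ≈? - a) ℚ.* [ b + t ≈0])
          ≡⟨ ∑F-select (- a) (λ t → [ b + t ≈0]) (λ eq → ≈0-cong (+-congˡ eq)) ⟩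
        [ b + - a ≈0]
          ≡⟨ 𝟏-cong (b + - a ≈? 0#) (j Fin.≟ k)
               (λ eq → ≡.sym (element-injective (τ-injective (x∙y⁻¹≈ε⇒x≈y b a eq))))
               (λ { refl → -‿inverseʳ a }) ⟩
        𝟏 (j Fin.≟ k)
          ≡⟨ solve 1 (λ z → con 1ℚ :* z :- con 0ℚ := z) refl (𝟏 (j Fin.≟ k)) ⟨
        1ℚ ℚ.* 𝟏 (j Fin.≟ k) ℚ.- 0ℚ ∎
        where
        a = τ.to (element j)
        b = τ.to (element k)

      energy : ∀ w → sumSquares (λ i → ((A · w) i ℚ.+ (A · w) i) ℚ.- ∑ℚ w)
        ℚ.≤ ι (suc q ℕ.+ suc q) ℚ.* sumSquares w
      energy w = ℚ.≤-trans (∑-mono-≤ pointwise) (ℚ.≤-trans (ℚ.≤-reflexive squares)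
        (ℚ.≤-trans (p-2s≤p (C ℚ.* W) (square-nonNeg (∑ℚ w)))
          (ℚ.≤-reflexive (≡.cong (ℚ._* W)
            (≡.sym (≡.trans (ι-+ (suc q) (suc q)) (≡.cong₂ ℚ._+_ (ι-+ 1 q) (ι-+ 1 q))))))))
        where
        C = (1ℚ ℚ.+ ι q) ℚ.+ (1ℚ ℚ.+ ι q)
        W = sumSquares w
        Sw Mw : Fin q → ℚ
        Sw i = ∑ℚ (λ j → χ (B i j) ℚ.* w j)
        Mw i = ∑ℚ (λ j → [ B i j ≈0] ℚ.* w j)
        squares : ∑ℚ (λ i → ι 2 ℚ.* (Sw i ℚ.* Sw i ℚ.+ Mw i ℚ.* Mw i)) ≡ C ℚ.* W ℚ.- ι 2 ℚ.* (∑ℚ w ℚ.* ∑ℚ w)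
        squares = begin
          ∑ℚ (λ i → ι 2 ℚ.* (Sw i ℚ.* Sw i ℚ.+ Mw i ℚ.* Mw i))
            ≡⟨ ≡.trans (≡.sym (*-distribˡ-sum (ι 2) (λ i → Sw i ℚ.* Sw i ℚ.+ Mw i ℚ.* Mw i)))
                 (≡.cong (ι 2 ℚ.*_) (∑-distrib-+ (λ i → Sw i ℚ.* Sw i) (λ i → Mw i ℚ.* Mw i))) ⟩
          ι 2 ℚ.* (sumSquares Sw ℚ.+ sumSquares Mw)
            ≡⟨ ≡.cong₂ (λ a b → ι 2 ℚ.* (a ℚ.+ b)) (gram (λ i j → χ (B i j)) w (ι q) 1ℚ χ-gram)
                 (gram (λ i j → [ B i j ≈0]) w 1ℚ 0ℚ ≈0-gram) ⟩
          ι 2 ℚ.* ((ι q ℚ.* W ℚ.- 1ℚ ℚ.* (∑ℚ w ℚ.* ∑ℚ w)) ℚ.+ (1ℚ ℚ.* W ℚ.- 0ℚ ℚ.* (∑ℚ w ℚ.* ∑ℚ w)))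
            ≡⟨ solve 3 (λ q W s → con (ι 2) :* ((q :* W :- con 1ℚ :* s) :+ (con 1ℚ :* W :- con 0ℚ :* s))
                 := ((con 1ℚ :+ q) :+ (con 1ℚ :+ q)) :* W :- con (ι 2) :* s) refl (ι q) W (∑ℚ w ℚ.* ∑ℚ w) ⟩
          C ℚ.* W ℚ.- ι 2 ℚ.* (∑ℚ w ℚ.* ∑ℚ w) ∎
        -- The -J part of Sᵀ S contributes -2 (∑ w)², which is dropped here.
        p-2s≤p : ∀ p {s} → 0ℚ ℚ.≤ s → p ℚ.- ι 2 ℚ.* s ℚ.≤ p
        p-2s≤p p {s} 0≤s = ℚ.≤-trans
          (ℚ.+-monoʳ-≤ p (ℚ.neg-antimono-≤ (ℚ.*-monoˡ-≤-nonNeg (ι 2) 0≤s)))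
          (ℚ.≤-reflexive (ℚ.+-identityʳ p))
        2A-J≡S-M : ∀ i → ((A · w) i ℚ.+ (A · w) i) ℚ.- ∑ℚ w ≡ Sw i ℚ.- Mw i
        2A-J≡S-M i = begin
          ((A · w) i ℚ.+ (A · w) i) ℚ.- ∑ℚ w
            ≡⟨ ≡.trans (∑-distrib-sub (λ j → ι (A i j) ℚ.* w j ℚ.+ ι (A i j) ℚ.* w j) w)
                 (≡.cong (ℚ._- ∑ℚ w) (∑-distrib-+ (λ j → ι (A i j) ℚ.* w j) (λ j → ι (A i j) ℚ.* w j))) ⟨
          ∑ℚ (λ j → (ι (A i j) ℚ.* w j ℚ.+ ι (A i j) ℚ.* w j) ℚ.- w j)
            ≡⟨ sum-cong-≗ (λ j → ≡.trans
                 (≡.cong (λ s → (s ℚ.* w j ℚ.+ s ℚ.* w j) ℚ.- w j) (ι-A i j))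
                 (solve 3 (λ s z w → (s :* w :+ s :* w) :- w := ((s :+ s) :+ z :- con 1ℚ) :* w :- z :* w) refl
                   [ B i j ∈Q] [ B i j ≈0] (w j))) ⟩
          ∑ℚ (λ j → χ (B i j) ℚ.* w j ℚ.- [ B i j ≈0] ℚ.* w j)
            ≡⟨ ∑-distrib-sub (λ j → χ (B i j) ℚ.* w j) (λ j → [ B i j ≈0] ℚ.* w j) ⟩
          Sw i ℚ.- Mw i ∎
        pointwise : ∀ i → (((A · w) i ℚ.+ (A · w) i) ℚ.- ∑ℚ w) ℚ.* (((A · w) i ℚ.+ (A · w) i) ℚ.- ∑ℚ w)
          ℚ.≤ ι 2 ℚ.* (Sw i ℚ.* Sw i ℚ.+ Mw i ℚ.* Mw i)
        pointwise i = ℚ.≤-trans (ℚ.≤-reflexive (≡.trans (≡.cong (λ d → d ℚ.* d) (2A-J≡S-M i))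
            (solve 2 (λ s m → (s :- m) :* (s :- m) := con (ι 2) :* (s :* s :+ m :* m) :- (s :+ m) :* (s :+ m)) refl (Sw i) (Mw i))))
          (ℚ.≤-trans (ℚ.+-monoʳ-≤ (ι 2 ℚ.* (Sw i ℚ.* Sw i ℚ.+ Mw i ℚ.* Mw i))
            (ℚ.neg-antimono-≤ (square-nonNeg (Sw i ℚ.+ Mw i)))) (ℚ.≤-reflexive (ℚ.+-identityʳ _)))

      2[q+1]<16[∣Q∣-1] : suc q ℕ.+ suc q ℕ.< 4 ℕ.* (4 ℕ.* (∣Q∣ ℕ.∸ 1))
      2[q+1]<16[∣Q∣-1] = ≡.subst (λ q → suc q ℕ.+ suc q ℕ.< 4 ℕ.* (4 ℕ.* (∣Q∣ ℕ.∸ 1))) 1+2∣Q∣≡q (go ∣Q∣ 2≤∣Q∣)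
        where
        go : ∀ k → 2 ℕ.≤ k → (2 ℕ.+ (k ℕ.+ k)) ℕ.+ (2 ℕ.+ (k ℕ.+ k)) ℕ.< 4 ℕ.* (4 ℕ.* (k ℕ.∸ 1))
        -- With degree k + 2 the claim becomes 12 + 4k < 16 + 16k.
        go (suc (suc k)) _ = ≡.subst₂ ℕ._<_ (lhs k) (rhs k)
          (ℕ.+-mono-<-≤ {12} {16} (ℕ.m≤m+n 13 3) (ℕ.*-monoˡ-≤ k {4} {16} (ℕ.m≤m+n 4 12)))
          where
          lhs : ∀ k → 12 ℕ.+ 4 ℕ.* k ≡ (2 ℕ.+ ((2 ℕ.+ k) ℕ.+ (2 ℕ.+ k))) ℕ.+ (2 ℕ.+ ((2 ℕ.+ k) ℕ.+ (2 ℕ.+ k)))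
          lhs = ℕ-Ring.solve-∀
          rhs : ∀ k → 16 ℕ.+ 16 ℕ.* k ≡ 4 ℕ.* (4 ℕ.* (1 ℕ.+ k))
          rhs = ℕ-Ring.solve-∀
        go (suc zero) (ℕ.s≤s ())

      ramanujan : Ramanujan A
      ramanujan = ∣Q∣ , undirected , regular , λ l (v , v≉0 , eigen) ∣l∣≉k →
        eigenvalue-bound A ∣Q∣ undirected regular (suc q ℕ.+ suc q) 2[q+1]<16[∣Q∣-1] energy l v eigen ∣l∣≉k v≉0

    -- The three graphs

    -x+s+x≈s : ∀ x s → (- x + s) + x ≈ s
    -x+s+x≈s x s = ≈-trans (+-comm (- x + s) x) (≈-trans (≈-sym (+-assoc x (- x) s))
      (≈-trans (+-congʳ (-‿inverseʳ x)) (+-identityˡ s)))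

    -x+[z+x]≈z : ∀ x z → - x + (z + x) ≈ z
    -x+[z+x]≈z x z = ≈-trans (≈-sym (+-assoc (- x) z x)) (-x+s+x≈s x z)

    identity : Bijection
    identity = bijection id id id id (λ _ → ≈-refl) (λ _ → ≈-refl)

    -- From y = -x + s one gets s = y + x, which is symmetric in x and y.
    paleySum-ramanujan : Ramanujan (PaleySum F)
    paleySum-ramanujan = SquareGraph.ramanujan (PaleySum F) identity identity
      (λ i j → let x = element i; y = element j in ι-edges (λ s x → - x + s) i j (y + x)
        (λ {s} eq → ≈-sym (≈-trans (+-congʳ (≈-sym eq)) (-x+s+x≈s x s)))
        (λ eq → ≈-trans (+-congˡ eq) (-x+[z+x]≈z x y)))
      (λ x y → square-resp-≈ (+-comm y x))

    module InvolutiveAutomorphism (σ : Carrier → Carrier)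
      (σ-cong : ∀ {x y} → x ≈ y → σ x ≈ σ y) (σ-involutive : ∀ x → σ (σ x) ≈ x)
      (σ-+ : ∀ x y → σ (x + y) ≈ σ x + σ y) (σ-square : ∀ {s} → NonzeroSquare s → NonzeroSquare (σ s))
      where

      σ-neg : ∀ x → σ (- x) ≈ - σ x
      σ-neg x = +-inverseʳ-unique (σ x) (σ (- x)) (≈-trans (≈-sym (σ-+ x (- x))) (≈-trans (σ-cong (-‿inverseʳ x)) σ0≈0))
        where
        σ0≈0 : σ 0# ≈ 0#
        σ0≈0 = x+x≈x⇒x≈0 (σ 0#) (≈-trans (≈-sym (σ-+ 0# 0#)) (σ-cong (+-identityˡ 0#)))

      automorphism negation : Bijection
      automorphism = bijection σ σ σ-cong σ-cong σ-involutive σ-involutive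
      negation  = bijection -_ -_ -‿cong -‿cong -‿involutive -‿involutive

      -- From y = σ(x + s) one gets s = σ y - x. Exchanging x and y gives σ x - y = -σ(σ y - x), so
      -- the graph is undirected because σ preserves Q and -1 is a square.
      twistedPaley-ramanujan : Ramanujan (TwistedPaley F σ)
      twistedPaley-ramanujan = SquareGraph.ramanujan (TwistedPaley F σ) automorphism negation
        (λ i j → let x = element i; y = element j in ι-edges (λ s x → σ (x + s)) i j (σ y - x)
          (λ {s} eq → ≈-sym (≈-trans
            (+-congʳ (≈-trans (σ-cong (≈-sym eq)) (σ-involutive (x + s)))) (x+s-x≈s x s)))
          (λ eq → ≈-trans (σ-cong (≈-trans (+-congˡ eq) (x+[z-x]≈z x (σ y)))) (σ-involutive y)))
        (λ x y sq → square-resp-≈ (negated x y) (square-* square-[-1] (σ-square sq)))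
        where
        x+s-x≈s : ∀ x s → (x + s) - x ≈ s
        x+s-x≈s x s = ≈-trans (+-congʳ (+-comm x s)) (≈-trans (+-assoc s x (- x))
          (≈-trans (+-congˡ (-‿inverseʳ x)) (+-identityʳ s)))
        x+[z-x]≈z : ∀ x z → x + (z - x) ≈ z
        x+[z-x]≈z x z = ≈-trans (≈-sym (+-assoc x z (- x))) (x+s-x≈s x z)
        negated : ∀ x y → - 1# * σ (σ y - x) ≈ σ x - y
        negated x y = ≈-trans (-1*x≈-x (σ (σ y - x))) (≈-trans
          (-‿cong (≈-trans (σ-+ (σ y) (- x)) (+-cong (σ-involutive y) (σ-neg x))))
          (≈-trans (≈-sym (-‿+-comm y (- σ x))) (≈-trans (+-congˡ (-‿involutive (σ x))) (+-comm (- y) (σ x)))))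

      -- Here s = σ y + x, and σ(σ y + x) = σ x + y, so stability of Q under σ gives the symmetry.
      twistedPaleySum-ramanujan : Ramanujan (TwistedPaleySum F σ)
      twistedPaleySum-ramanujan = SquareGraph.ramanujan (TwistedPaleySum F σ) automorphism identity
        (λ i j → let x = element i; y = element j in ι-edges (λ s x → σ (- x + s)) i j (σ y + x)
          (λ {s} eq → ≈-sym (≈-trans
            (+-congʳ (≈-trans (σ-cong (≈-sym eq)) (σ-involutive (- x + s)))) (-x+s+x≈s x s)))
          (λ eq → ≈-trans (σ-cong (≈-trans (+-congˡ eq) (-x+[z+x]≈z x (σ y)))) (σ-involutive y)))
        (λ x y sq → square-resp-≈ (≈-trans (σ-+ (σ y) x) (≈-trans (+-congʳ (σ-involutive y)) (+-comm y (σ x))))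
          (σ-square sq))

    module _ (p k : ℕ) (prime : Prime p) (q≡p^2k : q ≡ p ℕ.^ (2 ℕ.* k)) where
      open InvolutiveAutomorphism (power F (p ℕ.^ k))
        (^-congˡ (p ℕ.^ k)) (^-involutive {p} {k} q≡p^2k)
        (^p^k-+ prime (characteristic {e = 2 ℕ.* k} q≡p^2k) k)
        (λ (x , x≉0 , s≈xx) → x ^ (p ℕ.^ k) , ^-≉0 x≉0 (p ℕ.^ k) ,
          ≈-trans (^-congˡ (p ℕ.^ k) s≈xx) (^-distrib-* x x (p ℕ.^ k)))
        public using (twistedPaley-ramanujan; twistedPaleySum-ramanujan)

open import Data.Nat.Base using (_*_; _%_; _^_)

theorem5p4 : ∀ {c ℓ₁ ℓ₂ : Level} (q : ℕ) → IsPrimePower q → q % 4 ≡ 1 →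
    (F : FiniteField q c ℓ₁ ℓ₂) →
    Ramanujan (PaleySum F) ×
    (∀ (p k : ℕ) → Prime p → q ≡ p ^ (2 * k) →
    Ramanujan (TwistedPaley F (power F (p ^ k))) ×
    Ramanujan (TwistedPaleySum F (power F (p ^ k))))
theorem5p4 q _ q%4≡1 F = paleySum-ramanujan , λ p k prime q≡p^2k →
  twistedPaley-ramanujan p k prime q≡p^2k , twistedPaleySum-ramanujan p k prime q≡p^2k
  where open FiniteFieldProperties.Odd F q%4≡1
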